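{- Let $Z^{\diamondsuit}\colon\mathcal{H}^0\to\mathbb{Q}^{\mathbb{N}}$ be the $\mathbb{Z}$-linear map sending a word to the corresponding multiple zeta diamond value, let $\tau$ be the anti-automorphism of $\mathcal{H}=\mathbb{Z}\langle x,y\rangle$ interchanging $x$ and $y$, and let $\star$ be the product on $\mathcal{H}^{2,3}=\mathbb{Z}\langle z_2,z_3\rangle$ (all as defined in the context). Then for all $w_1,w_2\in\mathcal{H}^{2,3}$, \[ Z^{\diamondsuit}(w_1\tau(w_2))=Z^{\diamondsuit}(w_1\star w_2). \]
   Context: **Algebras.** $\mathcal{H}=\mathbb{Z}\langle x,y\rangle$ is the non-commutative polynomial ring over $\mathbb{Z}$ in two variables $x,y$. For each positive integer $k$ put $z_k=yx^{k-1}$. Define subrings $\mathcal{H}^{2,3}=\mathbb{Z}\langle z_2,z_3\rangle$ and $\mathcal{H}^0=\mathbb{Z}+y\mathcal{H}x$ of $\mathcal{H}$. A word in $\mathcal{H}^{2,3}$ is a (possibly empty) monomial in $z_2,z_3$. **The anti-automorphism $\tau$.** $\tau$ is the anti-automorphism of $\mathcal{H}$ (i.e. $\tau(uv)=\tau(v)\tau(u)$) with $\tau(x)=y$, $\tau(y)=x$. **The product $\star$.** $\star$ is the $\mathbb{Z}$-bilinear product on $\mathcal{H}^{2,3}$ defined inductively, for words $w,w'$ in $\mathcal{H}^{2,3}$, by - $w\star 1=1\star w=w$; - $wz_2\star w'=w\star w'z_2=(w\star w')z_2$; - $wz_3\star w'z_3=(w\star w'z_3)z_3+(wz_3\star w')z_3+(w\star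 w')z_2^3$. **Multiple zeta diamond values.** $\mathbb{N}$ is the set of positive integers. Every tuple $(k_1,\dots,k_r)$ of positive integers with $r\geq1$ and $k_r\geq2$ can be written uniquely as $(\{1\}^{a_1-1},b_1+1,\dots,\{1\}^{a_s-1},b_s+1)$ with $s\geq 1$ and positive integers $a_1,\dots,a_s,b_1,\dots,b_s$, where $\{1\}^n$ denotes $1$ repeated $n$ times; equivalently, $z_{k_1}\cdots z_{k_r}=y^{a_1}x^{b_1}\cdots y^{a_s}x^{b_s}$. For a positive integer $N$ put \[ \zeta^{\diamondsuit}_N(k_1,\dots,k_r)=\sum\ \prod_{i=1}^{s}\frac{1}{(N-n_{i,1})\cdots(N-n_{i,a_i})}\cdot\frac{1}{m_{i,1}\cdots m_{i,b_i}}\in\mathbb{Q}, \] where the sum runs over all integers $n_{i,j}$ ($1\le i\le s$, $1\le j\le a_i$) and $m_{i,j}$ ($1\le i\le s$, $1\le j\le b_i$) with $0<n_{i,1}\leq\cdots\leq n_{i,a_i}\leq m_{i,1}\leq\cdots\leq m_{i,b_i}<N$ for $1\le i\le s$ and $m_{i,b_i}<n_{i+1,1}$ for $1\le i\le s-1$. The multiple zeta diamond value is the sequence $\zeta^{\diamondsuit}(k_1,\dots,k_r)=(\zeta^{\diamondsuit}_N(k_1,\dots,k_r))_{N\in\mathbb{N}}\in\mathbb{Q}^{\mathbb{N}}$. $Z^{\diamondsuit}\colon\mathcal{H}^0\to\mathbb{Q}^{\mathbb{N}}$ is the $\mathbb{Z}$-linear map with $Z^{\diamondsuit}(1)=1$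 (the constant sequence $1$) and $Z^{\diamondsuit}(z_{k_1}\cdots z_{k_r})=\zeta^{\diamondsuit}(k_1,\dots,k_r)$ for $k_r\ge2$. -}

module Defs where

open import Data.Nat as ℕ using (ℕ; zero; suc; NonZero)
import Data.Nat.Properties as ℕₚ
import Data.Integer as ℤ hiding (+_)
open ℤ using (ℤ; 0ℤ; 1ℤ)
import Data.Integer.Properties as ℤₚ
open import Data.Rational as ℚ using (ℚ; 0ℚ; 1ℚ; _/_; toℚᵘ)
import Data.Rational.Properties as ℚₚ
open import Data.Rational.Unnormalised.Base as ℚᵘ using (mkℚᵘ; *≡*)
import Data.Rational.Unnormalised.Properties as ℚᵘₚ
open import Data.Bool using (if_then_else_)
open import Data.Empty using (⊥-elim)
open import Data.Unit using (⊤; tt)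
open import Data.Product using (_×_; _,_; proj₁; proj₂; map₁; map₂)
open import Data.List using (List; []; _∷_; [_]; _++_; _∷ʳ_; map; concatMap; foldr; filter; length;
  replicate; reverse; upTo; cartesianProduct; cartesianProductWith)
import Data.List.Properties as Listₚ
open import Data.List.NonEmpty using (List⁺; _∷_; _∷⁺_) renaming (toList to toList⁺)
open import Data.List.Relation.Unary.All as All using (All; []; _∷_)
import Data.List.Relation.Unary.All.Properties as Allₚ
open import Data.Vec as Vec using (Vec; []; _∷_)
open import Data.Vec.Relation.Unary.Linked using (Linked; linked?)
open import Function using (_∘_)
open import Relation.Binary.Definitions using (DecidableEquality)
open import Relation.Binary.PropositionalEquality
  using (_≡_; _≢_; refl; sym; trans; cong; cong₂; subst; module ≡-Reasoning)
open import Relation.Nullary using (Dec; yes; no; does; ¬_)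
open import Relation.Nullary.Decidable using (_×-dec_; dec-true; dec-false)

-- The free ℤ-module on B.  A list [(c₁ , b₁), …] represents Σ cᵢ bᵢ; basis
-- elements may repeat, so equality of elements is _≈_ below, and _++_ is
-- addition.
Lin : Set → Set
Lin B = List (ℤ × B)

⟨_⟩ : {B : Set} → B → Lin B
⟨ b ⟩ = [ 1ℤ , b ]

infixr 7 _•_
_•_ : {B : Set} → ℤ → Lin B → Lin B
c • p = map (map₁ (c ℤ.*_)) p

mapBasis : {B C : Set} → (B → C) → Lin B → Lin C
mapBasis f = map (map₂ f)

bilinear : {B C D : Set} → (B → C → Lin D) → Lin B → Lin C → Lin D
bilinear f p q =
  concatMap (λ (c , b) → concatMap (λ (d , b′) → (c ℤ.* d) • f b b′) q) p

evalℚ : {B : Set} → (B → ℚ) → Lin B → ℚ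
evalℚ f []            = 0ℚ
evalℚ f ((c , b) ∷ p) = c / 1 ℚ.* f b ℚ.+ evalℚ f p

-- ℋ = ℤ⟨x,y⟩.
data Letter : Set where
  x y : Letter

Word : Set
Word = List Letter

ℋ : Set
ℋ = Lin Word

infixl 7 _·_
_·_ : ℋ → ℋ → ℋ
_·_ = bilinear (λ u v → ⟨ u ++ v ⟩)

swap : Letter → Letter
swap x = y
swap y = x

τ : ℋ → ℋ
τ = mapBasis (reverse ∘ map swap)

_≟ˡ_ : DecidableEquality Letter
x ≟ˡ x = yes refl
x ≟ˡ y = no λ ()
y ≟ˡ x = no λ ()
y ≟ˡ y = yes refl

_≟ʷ_ : DecidableEquality Word
_≟ʷ_ = Listₚ.≡-dec _≟ˡ_

coeff : ℋ → Word → ℤ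
coeff []            w = 0ℤ
coeff ((c , v) ∷ p) w = (if does (v ≟ʷ w) then c else 0ℤ) ℤ.+ coeff p w

infix 4 _≈_
_≈_ : ℋ → ℋ → Set
p ≈ q = ∀ w → coeff p w ≡ coeff q w

z : (k : ℕ) .{{_ : NonZero k}} → Word
z k = y ∷ replicate (k ℕ.∸ 1) x

-- ℋ²³ = ℤ⟨z₂,z₃⟩ as the free ring on z₂ and z₃; words grow on the right.
infixl 8 _z₂ _z₃
data Word²³ : Set where
  ε   : Word²³
  _z₂ : Word²³ → Word²³
  _z₃ : Word²³ → Word²³

ℋ²³ : Set
ℋ²³ = Lin Word²³

ιʷ : Word²³ → Word
ιʷ ε      = []
ιʷ (w z₂) = ιʷ w ++ z 2
ιʷ (w z₃) = ιʷ w ++ z 3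

-- By injectivity, ι below identifies ℋ²³ with the subring of ℋ generated by z₂ and z₃.
ιʷ-injective : ∀ {v w} → ιʷ v ≡ ιʷ w → v ≡ w
ιʷ-injective {v} {w} = go v w
  where
  y≢x : y ≢ x
  y≢x ()
  yx≢ : ∀ s t → s ++ z 2 ≢ t ++ z 3
  yx≢ s t eq = y≢x (Listₚ.∷ʳ-injectiveʳ s (t ∷ʳ y)
    (Listₚ.∷ʳ-injectiveˡ (s ∷ʳ y) (t ∷ʳ y ∷ʳ x) (begin
      s ∷ʳ y ∷ʳ x          ≡⟨ Listₚ.++-assoc s [ y ] [ x ] ⟩
      s ++ z 2             ≡⟨ eq ⟩
      t ++ z 3             ≡⟨ Listₚ.++-assoc t [ y ] (replicate 2 x) ⟨
      t ∷ʳ y ++ replicate 2 x  ≡⟨ Listₚ.++-assoc (t ∷ʳ y) [ x ] [ x ] ⟨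
      t ∷ʳ y ∷ʳ x ∷ʳ x     ∎)))
    where open ≡-Reasoning
  []≢ : ∀ s {l t} → [] ≢ s ++ l ∷ t
  []≢ []      ()
  []≢ (_ ∷ _) ()
  go : ∀ v w → ιʷ v ≡ ιʷ w → v ≡ w
  go ε      ε      eq = refl
  go ε      (w z₂) eq = ⊥-elim ([]≢ (ιʷ w) eq)
  go ε      (w z₃) eq = ⊥-elim ([]≢ (ιʷ w) eq)
  go (v z₂) ε      eq = ⊥-elim ([]≢ (ιʷ v) (sym eq))
  go (v z₃) ε      eq = ⊥-elim ([]≢ (ιʷ v) (sym eq))
  go (v z₂) (w z₃) eq = ⊥-elim (yx≢ (ιʷ v) (ιʷ w) eq)
  go (v z₃) (w z₂) eq = ⊥-elim (yx≢ (ιʷ w) (ιʷ v) (sym eq))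
  go (v z₂) (w z₂) eq = cong _z₂ (go v w (Listₚ.++-cancelʳ (z 2) (ιʷ v) (ιʷ w) eq))
  go (v z₃) (w z₃) eq = cong _z₃ (go v w (Listₚ.++-cancelʳ (z 3) (ιʷ v) (ιʷ w) eq))

ι : ℋ²³ → ℋ
ι = mapBasis ιʷ

-- The defining equations of ⋆ overlap; these clauses pick one of them in each
-- case, and ⋆ʷ-εʳ and ⋆ʷ-z₂ʳ show that the remaining ones hold as well.
infixl 7 _⋆ʷ_ _⋆_
_⋆ʷ_ : Word²³ → Word²³ → ℋ²³
ε      ⋆ʷ w′     = ⟨ w′ ⟩
w z₂   ⋆ʷ w′     = mapBasis _z₂ (w ⋆ʷ w′)
w z₃   ⋆ʷ ε      = ⟨ w z₃ ⟩
w z₃   ⋆ʷ w′ z₂  = mapBasis _z₂ (w z₃ ⋆ʷ w′)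
w z₃   ⋆ʷ w′ z₃  = mapBasis _z₃ (w ⋆ʷ w′ z₃)
                ++ mapBasis _z₃ (w z₃ ⋆ʷ w′)
                ++ mapBasis (λ v → v z₂ z₂ z₂) (w ⋆ʷ w′)

⋆ʷ-εʳ : ∀ w → w ⋆ʷ ε ≡ ⟨ w ⟩
⋆ʷ-εʳ ε      = refl
⋆ʷ-εʳ (w z₂) = cong (mapBasis _z₂) (⋆ʷ-εʳ w)
⋆ʷ-εʳ (w z₃) = refl

⋆ʷ-z₂ʳ : ∀ w w′ → w ⋆ʷ w′ z₂ ≡ mapBasis _z₂ (w ⋆ʷ w′)
⋆ʷ-z₂ʳ ε      w′ = refl
⋆ʷ-z₂ʳ (w z₂) w′ = cong (mapBasis _z₂) (⋆ʷ-z₂ʳ w w′)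
⋆ʷ-z₂ʳ (w z₃) w′ = refl

_⋆_ : ℋ²³ → ℋ²³ → ℋ²³
_⋆_ = bilinear _⋆ʷ_

-- ℋ⁰ = ℤ + yℋx.
constant+y_x : ℤ → ℋ → ℋ
constant+y_x c q = [ c , [] ] ++ ⟨ [ y ] ⟩ · q · ⟨ [ x ] ⟩

infix 4 _∈ℋ⁰
record _∈ℋ⁰ (p : ℋ) : Set where
  constructor mk∈
  field
    c  : ℤ
    q  : ℋ
    eq : p ≈ constant+y_x c q

-- A list (α₁ , β₁) ∷ … ∷ (αₛ , βₛ) stands for the exponents aᵢ = αᵢ + 1 and
-- bᵢ = βᵢ + 1, i.e. for the word y^a₁ x^b₁ ⋯ y^aₛ x^bₛ.
Exponents : Set
Exponents = List⁺ (ℕ × ℕ)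

wordOf : List (ℕ × ℕ) → Word
wordOf []             = []
wordOf ((α , β) ∷ es) = replicate (suc α) y ++ replicate (suc β) x ++ wordOf es

raiseα raiseβ : Exponents → Exponents
raiseα ((α , β) ∷ es) = (suc α , β) ∷ es
raiseβ ((α , β) ∷ es) = (α , suc β) ∷ es

-- exponents u are the exponents of the word y u x (see wordOf-exponents).
exponents : Word → Exponents
exponents []          = (0 , 0) ∷ []
exponents (y ∷ u)     = raiseα (exponents u)
exponents (x ∷ [])    = raiseβ (exponents [])
exponents (x ∷ x ∷ u) = raiseβ (exponents (x ∷ u))
exponents (x ∷ y ∷ u) = (0 , 0) ∷⁺ exponents u

-- The tuples (n_{i,1},…,n_{i,aᵢ}) and (m_{i,1},…,m_{i,bᵢ}) for all i.
Indices : List (ℕ × ℕ) → Set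
Indices = All (λ (α , β) → Vec ℕ (suc α) × Vec ℕ (suc β))

ValidBlock : ℕ → ∀ {α β} → Vec ℕ (suc α) → Vec ℕ (suc β) → Set
ValidBlock N n m =
  0 ℕ.< Vec.head n × Linked ℕ._≤_ (n Vec.++ m) × Vec.last m ℕ.< N

Valid : ℕ → ∀ {es} → Indices es → Set
Valid N []                           = ⊤
Valid N ((n , m) ∷ [])               = ValidBlock N n m
Valid N ((n , m) ∷ (n′ , m′) ∷ rest) =
  ValidBlock N n m × Vec.last m ℕ.< Vec.head n′ × Valid N ((n′ , m′) ∷ rest)

validBlock? : ∀ N {α β} (n : Vec ℕ (suc α)) (m : Vec ℕ (suc β)) → Dec (ValidBlock N n m)
validBlock? N n m =
  (0 ℕ.<? Vec.head n) ×-dec linked? ℕ._≤?_ (n Vec.++ m) ×-dec (Vec.last m ℕ.<? N)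

valid? : ∀ N {es} (i : Indices es) → Dec (Valid N i)
valid? N []                           = yes tt
valid? N ((n , m) ∷ [])               = validBlock? N n m
valid? N ((n , m) ∷ (n′ , m′) ∷ rest) =
  validBlock? N n m ×-dec (Vec.last m ℕ.<? Vec.head n′) ×-dec valid? N ((n′ , m′) ∷ rest)

vectors : List ℕ → (k : ℕ) → List (Vec ℕ k)
vectors range zero    = [ [] ]
vectors range (suc k) = cartesianProductWith _∷_ range (vectors range k)

indices : List ℕ → (es : List (ℕ × ℕ)) → List (Indices es)
indices range []             = [ [] ]
indices range ((α , β) ∷ es) =
  cartesianProductWith _∷_
    (cartesianProduct (vectors range (suc α)) (vectors range (suc β)))
    (indices range es)

-- 1/n for n > 0; the value at 0 is never used, since a valid index j satisfies
-- 0 < j < N.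
recip : ℕ → ℚ
recip zero    = 0ℚ
recip (suc n) = 1ℤ / suc n

∑ ∏ : List ℚ → ℚ
∑ = foldr ℚ._+_ 0ℚ
∏ = foldr ℚ._*_ 1ℚ

summand : ℕ → ∀ {es} → Indices es → ℚ
summand N []               = 1ℚ
summand N ((n , m) ∷ rest) =
  ∏ (map (λ j → recip (N ℕ.∸ j)) (Vec.toList n)) ℚ.*
  ∏ (map recip (Vec.toList m)) ℚ.*
  summand N rest

-- Sequences indexed by the positive integers.
ℚ^ℕ : Set
ℚ^ℕ = (N : ℕ) .{{_ : NonZero N}} → ℚ

infix 4 _≗_
_≗_ : ℚ^ℕ → ℚ^ℕ → Set
f ≗ g = (N : ℕ) .{{_ : NonZero N}} → f N ≡ g N

-- Every valid index lies in {0,…,N-1} = upTo N, so the enumeration is complete.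
ζ◇ : Exponents → ℚ^ℕ
ζ◇ es N =
  ∑ (map (summand N) (filter (valid? N) (indices (upTo N) (toList⁺ es))))

-- The value does not depend on the chosen decomposition of p: see Z◇-cong.
Z◇ : (p : ℋ) → p ∈ℋ⁰ → ℚ^ℕ
Z◇ p (mk∈ c q _) N = c / 1 ℚ.+ evalℚ (λ u → ζ◇ (exponents u) N) q

wordOf-exponents : ∀ u → wordOf (toList⁺ (exponents u)) ≡ y ∷ u ∷ʳ x
wordOf-exponents []          = refl
wordOf-exponents (y ∷ u)     = cong (y ∷_) (wordOf-exponents u)
wordOf-exponents (x ∷ [])    = refl
wordOf-exponents (x ∷ x ∷ u) with exponents (x ∷ u) | wordOf-exponents (x ∷ u)
... | (zero  , β) ∷ es | eq = cong (λ v → y ∷ x ∷ v) (Listₚ.∷-injectiveʳ eq)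
... | (suc α , β) ∷ es | ()
wordOf-exponents (x ∷ y ∷ u) = cong (λ v → y ∷ x ∷ v) (wordOf-exponents u)

yx-injective : ∀ {u v : Word} → y ∷ u ∷ʳ x ≡ y ∷ v ∷ʳ x → u ≡ v
yx-injective {u} {v} eq = Listₚ.∷ʳ-injectiveˡ u v (Listₚ.∷-injectiveʳ eq)

y·x : ℋ → ℋ
y·x q = mapBasis (λ u → y ∷ u ∷ʳ x) q

constant+y·x : ∀ c q → constant+y_x c q ≡ (c , []) ∷ y·x q
constant+y·x c q = cong ((c , []) ∷_) (go q)
  where
  go : ∀ q → ⟨ [ y ] ⟩ · q · ⟨ [ x ] ⟩ ≡ y·x q
  go []            = refl
  go ((d , u) ∷ q) = cong₂ _∷_ (cong (_, y ∷ u ∷ʳ x) lem) (go q)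
    where
    lem : (1ℤ ℤ.* d ℤ.* 1ℤ) ℤ.* 1ℤ ℤ.* 1ℤ ≡ d
    lem = trans (ℤₚ.*-identityʳ _) (trans (ℤₚ.*-identityʳ _)
            (trans (ℤₚ.*-identityʳ _) (ℤₚ.*-identityˡ d)))

coeff-y·x : ∀ q u → coeff (y·x q) (y ∷ u ∷ʳ x) ≡ coeff q u
coeff-y·x []            u = refl
coeff-y·x ((d , v) ∷ q) u with v ≟ʷ u
... | yes refl
      rewrite dec-true ((y ∷ u ∷ʳ x) ≟ʷ (y ∷ u ∷ʳ x)) refl
      = cong (d ℤ.+_) (coeff-y·x q u)
... | no v≢u
      rewrite dec-false ((y ∷ v ∷ʳ x) ≟ʷ (y ∷ u ∷ʳ x)) (v≢u ∘ yx-injective)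
      = cong (0ℤ ℤ.+_) (coeff-y·x q u)

coeff-y·x-[] : ∀ q → coeff (y·x q) [] ≡ 0ℤ
coeff-y·x-[] []            = refl
coeff-y·x-[] ((d , v) ∷ q) = trans (ℤₚ.+-identityˡ _) (coeff-y·x-[] q)

coeff-constant : ∀ c q → coeff (constant+y_x c q) [] ≡ c
coeff-constant c q =
  trans (cong (λ r → coeff r []) (constant+y·x c q))
    (trans (cong (c ℤ.+_) (coeff-y·x-[] q)) (ℤₚ.+-identityʳ c))

coeff-yux : ∀ c q u → coeff (constant+y_x c q) (y ∷ u ∷ʳ x) ≡ coeff q u
coeff-yux c q u =
  trans (cong (λ r → coeff r (y ∷ u ∷ʳ x)) (constant+y·x c q))
    (trans (ℤₚ.+-identityˡ _) (coeff-y·x q u))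

/1-homo-+ : ∀ c d → (c ℤ.+ d) / 1 ≡ c / 1 ℚ.+ d / 1
/1-homo-+ c d = ℚₚ.toℚᵘ-injective (begin
  toℚᵘ ((c ℤ.+ d) / 1)            ≈⟨ ℚₚ.toℚᵘ-fromℚᵘ (mkℚᵘ (c ℤ.+ d) 0) ⟩
  mkℚᵘ (c ℤ.+ d) 0                ≈⟨ *≡* (cong (ℤ._* 1ℤ) (sym lem)) ⟩
  mkℚᵘ c 0 ℚᵘ.+ mkℚᵘ d 0          ≈⟨ ℚᵘₚ.+-cong (ℚₚ.toℚᵘ-fromℚᵘ (mkℚᵘ c 0)) (ℚₚ.toℚᵘ-fromℚᵘ (mkℚᵘ d 0)) ⟨
  toℚᵘ (c / 1) ℚᵘ.+ toℚᵘ (d / 1)  ≈⟨ ℚₚ.toℚᵘ-homo-+ (c / 1) (d / 1) ⟨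
  toℚᵘ (c / 1 ℚ.+ d / 1)          ∎)
  where
  open ℚᵘₚ.≃-Reasoning
  lem : c ℤ.* 1ℤ ℤ.+ d ℤ.* 1ℤ ≡ c ℤ.+ d
  lem = cong₂ ℤ._+_ (ℤₚ.*-identityʳ c) (ℤₚ.*-identityʳ d)

module _ (f : Word → ℚ) where

  remove : Word → ℋ → ℋ
  remove w []            = []
  remove w ((c , v) ∷ p) with v ≟ʷ w
  ... | yes _ = remove w p
  ... | no  _ = (c , v) ∷ remove w p

  length-remove : ∀ w p → length (remove w p) ℕ.≤ length p
  length-remove w []            = ℕ.z≤n
  length-remove w ((c , v) ∷ p) with v ≟ʷ w
  ... | yes _ = ℕₚ.m≤n⇒m≤1+n (length-remove w p)
  ... | no  _ = ℕ.s≤s (length-remove w p)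

  coeff-remove-≡ : ∀ w p → coeff (remove w p) w ≡ 0ℤ
  coeff-remove-≡ w []            = refl
  coeff-remove-≡ w ((c , v) ∷ p) with v ≟ʷ w
  ... | yes _  = coeff-remove-≡ w p
  ... | no v≢w rewrite dec-false (v ≟ʷ w) v≢w =
    trans (ℤₚ.+-identityˡ _) (coeff-remove-≡ w p)

  coeff-remove-≢ : ∀ w p {v} → w ≢ v → coeff (remove w p) v ≡ coeff p v
  coeff-remove-≢ w []             w≢v = refl
  coeff-remove-≢ w ((c , v′) ∷ p) {v} w≢v with v′ ≟ʷ w
  ... | yes refl rewrite dec-false (v′ ≟ʷ v) w≢v =
    trans (coeff-remove-≢ w p w≢v) (sym (ℤₚ.+-identityˡ _))
  ... | no _ = cong ((if does (v′ ≟ʷ v) then c else 0ℤ) ℤ.+_) (coeff-remove-≢ w p w≢v)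

  evalℚ-remove : ∀ w p → evalℚ f p ≡ coeff p w / 1 ℚ.* f w ℚ.+ evalℚ f (remove w p)
  evalℚ-remove w [] = sym (trans (ℚₚ.+-identityʳ _) (ℚₚ.*-zeroˡ (f w)))
  evalℚ-remove w ((c , v) ∷ p) with v ≟ʷ w
  ... | yes refl = begin
    c / 1 ℚ.* f w ℚ.+ evalℚ f p                ≡⟨ cong (c / 1 ℚ.* f w ℚ.+_) (evalℚ-remove w p) ⟩
    c / 1 ℚ.* f w ℚ.+ (k / 1 ℚ.* f w ℚ.+ r)    ≡⟨ ℚₚ.+-assoc (c / 1 ℚ.* f w) _ _ ⟨
    c / 1 ℚ.* f w ℚ.+ k / 1 ℚ.* f w ℚ.+ r      ≡⟨ cong (ℚ._+ r) (ℚₚ.*-distribʳ-+ (f w) (c / 1) (k / 1)) ⟨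
    (c / 1 ℚ.+ k / 1) ℚ.* f w ℚ.+ r            ≡⟨ cong (λ t → t ℚ.* f w ℚ.+ r) (/1-homo-+ c k) ⟨
    (c ℤ.+ k) / 1 ℚ.* f w ℚ.+ r                ∎
    where
    open ≡-Reasoning
    k = coeff p w
    r = evalℚ f (remove w p)
  ... | no _ = begin
    a ℚ.+ evalℚ f p               ≡⟨ cong (a ℚ.+_) (evalℚ-remove w p) ⟩
    a ℚ.+ (k / 1 ℚ.* f w ℚ.+ r)   ≡⟨ ℚₚ.+-assoc a _ _ ⟨
    a ℚ.+ k / 1 ℚ.* f w ℚ.+ r     ≡⟨ cong (ℚ._+ r) (ℚₚ.+-comm a _) ⟩
    k / 1 ℚ.* f w ℚ.+ a ℚ.+ r     ≡⟨ ℚₚ.+-assoc (k / 1 ℚ.* f w) a r ⟩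
    k / 1 ℚ.* f w ℚ.+ (a ℚ.+ r)   ≡⟨ cong (λ t → t / 1 ℚ.* f w ℚ.+ (a ℚ.+ r)) (ℤₚ.+-identityˡ k) ⟨
    (0ℤ ℤ.+ k) / 1 ℚ.* f w ℚ.+ (a ℚ.+ r) ∎
    where
    open ≡-Reasoning
    a = c / 1 ℚ.* f v
    k = coeff p w
    r = evalℚ f (remove w p)

  evalℚ-remove-cong : ∀ w p q → coeff p w ≡ coeff q w →
    evalℚ f (remove w p) ≡ evalℚ f (remove w q) → evalℚ f p ≡ evalℚ f q
  evalℚ-remove-cong w p q eq eq′ = trans (evalℚ-remove w p)
    (trans (cong₂ (λ k r → k / 1 ℚ.* f w ℚ.+ r) eq eq′) (sym (evalℚ-remove w q)))

  remove-≈ : ∀ w {p q} → p ≈ q → remove w p ≈ remove w q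
  remove-≈ w {p} {q} p≈q v with w ≟ʷ v
  ... | yes refl = trans (coeff-remove-≡ w p) (sym (coeff-remove-≡ w q))
  ... | no w≢v   = trans (coeff-remove-≢ w p w≢v)
                     (trans (p≈q v) (sym (coeff-remove-≢ w q w≢v)))

  length-remove-∷ : ∀ c w p → length (remove w ((c , w) ∷ p)) ℕ.≤ length p
  length-remove-∷ c w p with w ≟ʷ w
  ... | yes _  = length-remove w p
  ... | no w≢w = ⊥-elim (w≢w refl)

  evalℚ-cong : ∀ {p q} → p ≈ q → evalℚ f p ≡ evalℚ f q
  evalℚ-cong {p} {q} = go (length p ℕ.+ length q) p q ℕₚ.≤-refl
    where
    go : ∀ n p q → length p ℕ.+ length q ℕ.≤ n → p ≈ q → evalℚ f p ≡ evalℚ f q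
    go n       []                []                _         _   = refl
    go (suc n) p@((c , w) ∷ p′) q                 (ℕ.s≤s l) p≈q =
      evalℚ-remove-cong w p q (p≈q w) (go n (remove w p) (remove w q)
        (ℕₚ.≤-trans (ℕₚ.+-mono-≤ (length-remove-∷ c w p′) (length-remove w q)) l)
        (remove-≈ w {p} {q} p≈q))
    go (suc n) []                q@((c , w) ∷ q′) (ℕ.s≤s l) p≈q =
      evalℚ-remove-cong w [] q (p≈q w) (go n [] (remove w q)
        (ℕₚ.≤-trans (length-remove-∷ c w q′) l)
        (remove-≈ w {[]} {q} p≈q))

Z◇-cong : ∀ {p p′} (h : p ∈ℋ⁰) (h′ : p′ ∈ℋ⁰) → p ≈ p′ → Z◇ p h ≗ Z◇ p′ h′
Z◇-cong (mk∈ c q eq) (mk∈ c′ q′ eq′) p≈p′ N =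
  cong₂ (λ d r → d / 1 ℚ.+ r) c≡c′ (evalℚ-cong (λ u → ζ◇ (exponents u) N) {q} {q′} q≈q′)
  where
  both : constant+y_x c q ≈ constant+y_x c′ q′
  both w = trans (sym (eq w)) (trans (p≈p′ w) (eq′ w))
  c≡c′ : c ≡ c′
  c≡c′ = trans (sym (coeff-constant c q)) (trans (both []) (coeff-constant c′ q′))
  q≈q′ : q ≈ q′
  q≈q′ u = trans (sym (coeff-yux c q u)) (trans (both (y ∷ u ∷ʳ x)) (coeff-yux c′ q′ u))

data Word⁰ : Word → Set where
  one : Word⁰ []
  yux : ∀ u → Word⁰ (y ∷ u ∷ʳ x)

All⁰ : ℋ → Set
All⁰ = All (Word⁰ ∘ proj₂)

constant-part : ∀ {p} → All⁰ p → ℤ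
constant-part                  []             = 0ℤ
constant-part {(d , _) ∷ _}    (one ∷ as)     = d ℤ.+ constant-part as
constant-part                  (yux _ ∷ as)   = constant-part as

y·x-part : ∀ {p} → All⁰ p → ℋ
y·x-part                  []             = []
y·x-part                  (one ∷ as)     = y·x-part as
y·x-part {(d , _) ∷ _}    (yux u ∷ as)   = (d , u) ∷ y·x-part as

All⁰⇒∈ℋ⁰ : ∀ {p} → All⁰ p → p ∈ℋ⁰
All⁰⇒∈ℋ⁰ {p} as = mk∈ (constant-part as) (y·x-part as) λ w →
  trans (go as w) (cong (λ r → coeff r w) (sym (constant+y·x (constant-part as) (y·x-part as))))
  where
  go : ∀ {p} (as : All⁰ p) → p ≈ (constant-part as , []) ∷ y·x (y·x-part as)
  go [] []      = refl
  go [] (_ ∷ _) = refl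
  go {(d , _) ∷ p} (one ∷ as) []      =
    trans (cong (d ℤ.+_) (go as [])) (sym (ℤₚ.+-assoc d (constant-part as) _))
  go {(d , _) ∷ p} (one ∷ as) w@(_ ∷ _) = trans (ℤₚ.+-identityˡ _) (go as w)
  go {(d , v) ∷ p} (yux u ∷ as) w = begin
    a ℤ.+ coeff p w    ≡⟨ cong (a ℤ.+_) (go as w) ⟩
    a ℤ.+ (b ℤ.+ r)    ≡⟨ ℤₚ.+-assoc a b r ⟨
    a ℤ.+ b ℤ.+ r      ≡⟨ cong (ℤ._+ r) (ℤₚ.+-comm a b) ⟩
    b ℤ.+ a ℤ.+ r      ≡⟨ ℤₚ.+-assoc b a r ⟩
    b ℤ.+ (a ℤ.+ r)    ∎
    where
    open ≡-Reasoning
    a = if does ((y ∷ u ∷ʳ x) ≟ʷ w) then d else 0ℤ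
    b = if does ([] ≟ʷ w) then constant-part as else 0ℤ
    r = coeff (y·x (y·x-part as)) w

Word⁰-++ : ∀ {u v} → Word⁰ u → Word⁰ v → Word⁰ (u ++ v)
Word⁰-++ one     b       = b
Word⁰-++ (yux u) one     = subst Word⁰ (sym (Listₚ.++-identityʳ _)) (yux u)
Word⁰-++ (yux u) (yux v) = subst Word⁰ (cong (y ∷_) eq) (yux (u ++ x ∷ y ∷ v))
  where
  eq : (u ++ x ∷ y ∷ v) ∷ʳ x ≡ (u ∷ʳ x) ++ (y ∷ v ∷ʳ x)
  eq = trans (Listₚ.++-assoc u (x ∷ y ∷ v) [ x ])
         (sym (Listₚ.++-assoc u [ x ] (y ∷ v ∷ʳ x)))

Word⁰-τ : ∀ {w} → Word⁰ w → Word⁰ (reverse (map swap w))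
Word⁰-τ one     = one
Word⁰-τ (yux u) = subst Word⁰ (sym eq) (yux (reverse (map swap u)))
  where
  open ≡-Reasoning
  eq : reverse (x ∷ map swap (u ∷ʳ x)) ≡ y ∷ reverse (map swap u) ∷ʳ x
  eq = begin
    reverse (x ∷ map swap (u ∷ʳ x))    ≡⟨ Listₚ.unfold-reverse x (map swap (u ∷ʳ x)) ⟩
    reverse (map swap (u ∷ʳ x)) ∷ʳ x   ≡⟨ cong (λ t → reverse t ∷ʳ x) (Listₚ.map-++ swap u [ x ]) ⟩
    reverse (map swap u ∷ʳ y) ∷ʳ x     ≡⟨ cong (_∷ʳ x) (Listₚ.reverse-++ (map swap u) [ y ]) ⟩
    y ∷ reverse (map swap u) ∷ʳ x      ∎

Word⁰-ιʷ : ∀ w → Word⁰ (ιʷ w)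
Word⁰-ιʷ ε      = one
Word⁰-ιʷ (w z₂) = Word⁰-++ (Word⁰-ιʷ w) (yux [])
Word⁰-ιʷ (w z₃) = Word⁰-++ (Word⁰-ιʷ w) (yux [ x ])

All⁰-ι : ∀ w → All⁰ (ι w)
All⁰-ι w = Allₚ.map⁺ (All.universal (Word⁰-ιʷ ∘ proj₂) w)

All⁰-τ : ∀ {p} → All⁰ p → All⁰ (τ p)
All⁰-τ as = Allₚ.map⁺ (All.map Word⁰-τ as)

All⁰-· : ∀ {p q} → All⁰ p → All⁰ q → All⁰ (p · q)
All⁰-· as bs = Allₚ.concat⁺ (Allₚ.map⁺ (All.map (λ a →
  Allₚ.concat⁺ (Allₚ.map⁺ (All.map (λ b → Word⁰-++ a b ∷ []) bs))) as))

ι∈ℋ⁰ : ∀ w → ι w ∈ℋ⁰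
ι∈ℋ⁰ w = All⁰⇒∈ℋ⁰ (All⁰-ι w)

ι·τι∈ℋ⁰ : ∀ w₁ w₂ → ι w₁ · τ (ι w₂) ∈ℋ⁰
ι·τι∈ℋ⁰ w₁ w₂ = All⁰⇒∈ℋ⁰ (All⁰-· (All⁰-ι w₁) (All⁰-τ (All⁰-ι w₂)))

{-# OPTIONS --safe #-}
module Submission where

-- Put K = N - 1.  Summing out the indices of w₁ from the left and those of τ(w₂) from the
-- right (reflected by j ↦ N - j) gives functions of the last index that expand in the
-- ratios bin M n / bin K n, the discrete analogues of tⁿ, with coefficients a(w) given by
-- a(ε) = δ₀ and a(w z_k)ₙ = n⁻ᵏ ∑_{i<n} a(w)ᵢ, independent of N.  Vandermonde's identity then
-- turns Z◇ (w₁ τ(w₂)) at N into the connected sum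
--     T_K(w₁, w₂) = ∑_{m,n} a(w₁)ₘ a(w₂)ₙ bin K (m+n) / (bin K m · bin K n).
-- Telescoping identities for the connector give
--     T_{K+1}(w z₂, v)    - T_K(w z₂, v)    = N⁻² T_K(w, v),
--     T_{K+1}(w z₃, v z₃) - T_K(w z₃, v z₃) = N⁻³ (T_K(w, v z₃) + T_K(w z₃, v))
--                                             + N⁻² T_K(w z₂, v z₂),
-- and T_{K+1}(w z₃, ε) - T_K(w z₃, ε) = N⁻³ T_K(w, ε).  These are also the increments of
-- T_K(w₁ ⋆ w₂, ε), so T_K(w₁, w₂) = T_K(w₁ ⋆ w₂, ε) follows by induction.

-- The model is the iterated integral. With M = tK and K large, bin M n / bin K n tends to tⁿ, and
-- the weights 1/j of x and 1/(N - j) of y play the roles of dt/t and dt/(1 - t). `coef w` lists the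
-- power series coefficients of the multiple polylogarithm of w, and the discrete sums act on
-- coefficients exactly as the integrals do, with no error term. The reflection j ↦ N - j exchanges
-- the two weights and so undoes τ: the tail τ(w₂) is described by the coefficients of w₂ itself.
--
-- Against ε the connector is 1 for m ≤ K and 0 beyond, so T_K(w, ε) is the multiple harmonic sum of
-- w truncated at K, and appending z_k multiplies increments in the simplest way. The shape of ⋆
-- then comes from one splitting, N = α + β + (N - α - β), where α and β are the two summation
-- indices. The first two parts lower one argument each; the third leaves T_K(w z₂, v z₂) with
-- factor N⁻², the increment of words ending in z₂³.
--
-- The main nuisance is the edge: reciprocals of binomials are 0 out of range, and their recurrence
-- in K breaks just past it.

open import Defs
open import Data.Bool using (Bool; true; false; if_then_else_; _∧_)
import Data.Bool.Properties as Boolₚ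
open import Data.Integer as ℤ using (ℤ; 1ℤ)
import Data.Integer.Properties as ℤₚ
open import Data.List using (List; []; _∷_; _++_; _∷ʳ_; [_]; map; concatMap; filter; upTo;
  applyUpTo; replicate; reverse; cartesianProductWith; cartesianProduct)
import Data.List.Properties as Listₚ
open import Data.List.NonEmpty using (_∷_) renaming (toList to toList⁺)
open import Data.List.Relation.Unary.All using ([]; _∷_)
open import Data.Nat as ℕ using (ℕ; zero; suc; _∸_; _≤_; _<_; z≤n; s≤s; NonZero; _<ᵇ_; _≤ᵇ_)
import Data.Nat.Properties as ℕₚ
open import Data.Product using (_×_; _,_)
open import Data.Rational using (ℚ; 0ℚ; 1ℚ; _+_; _*_; _-_; _/_; toℚᵘ)
open import Data.Rational.Properties
import Data.Rational.Unnormalised.Base as ℚᵘ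
import Data.Rational.Unnormalised.Properties as ℚᵘₚ
open import Data.Sum using (inj₁; inj₂)
open import Data.Vec as Vec using (Vec; []; _∷_)
open import Data.Vec.Relation.Unary.Linked using (linked?)
open import Function using (_∘_; id)
open import Level using (0ℓ)
open import Relation.Binary.PropositionalEquality
  using (_≡_; refl; sym; trans; cong; cong₂; module ≡-Reasoning)
open import Relation.Nullary using (does)
open import Relation.Nullary.Decidable using (dec⇒maybe)
open import Relation.Unary using (Pred; Decidable)
open import Tactic.RingSolver using (solve-∀)
open import Tactic.RingSolver.Core.AlmostCommutativeRing
  using (AlmostCommutativeRing; fromCommutativeRing)

-- Naturals in ℚ, finite sums and binomial coefficients

ℚ-ring : AlmostCommutativeRing _ _
ℚ-ring = fromCommutativeRing +-*-commutativeRing (λ p → dec⇒maybe (0ℚ ≟ p))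

⟦_⟧ : ℕ → ℚ
⟦ zero ⟧  = 0ℚ
⟦ suc n ⟧ = 1ℚ + ⟦ n ⟧

⟦⟧-/1 : ∀ n → ⟦ n ⟧ ≡ ℤ.+ n / 1
⟦⟧-/1 zero    = refl
⟦⟧-/1 (suc n) = trans (cong (1ℚ +_) (⟦⟧-/1 n)) (sym (/1-homo-+ 1ℤ (ℤ.+ n)))

⟦⟧-+ : ∀ m n → ⟦ m ℕ.+ n ⟧ ≡ ⟦ m ⟧ + ⟦ n ⟧
⟦⟧-+ zero    n = sym (+-identityˡ _)
⟦⟧-+ (suc m) n = trans (cong (1ℚ +_) (⟦⟧-+ m n)) (sym (+-assoc 1ℚ ⟦ m ⟧ ⟦ n ⟧))

⟦⟧-∸ : ∀ {m n} → n ≤ m → ⟦ m ∸ n ⟧ ≡ ⟦ m ⟧ - ⟦ n ⟧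
⟦⟧-∸ {m}     z≤n       = sym (+-identityʳ ⟦ m ⟧)
⟦⟧-∸ {suc m} {suc n} (s≤s n≤m) = trans (⟦⟧-∸ n≤m) (shift ⟦ m ⟧ ⟦ n ⟧ 1ℚ)
  where
  shift : ∀ a b c → a - b ≡ (c + a) - (c + b)
  shift = solve-∀ ℚ-ring

⟦⟧*recip : ∀ n → ⟦ suc n ⟧ * recip (suc n) ≡ 1ℚ
⟦⟧*recip n = toℚᵘ-injective (begin
  toℚᵘ (⟦ suc n ⟧ * recip (suc n))                   ≈⟨ toℚᵘ-homo-* ⟦ suc n ⟧ (recip (suc n)) ⟩
  toℚᵘ ⟦ suc n ⟧ ℚᵘ.* toℚᵘ (recip (suc n))
    ≡⟨ cong (λ p → toℚᵘ p ℚᵘ.* toℚᵘ (recip (suc n))) (⟦⟧-/1 (suc n)) ⟩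
  toℚᵘ (ℤ.+ suc n / 1) ℚᵘ.* toℚᵘ (1ℤ / suc n)
    ≈⟨ ℚᵘₚ.*-cong (toℚᵘ-fromℚᵘ (ℚᵘ.mkℚᵘ (ℤ.+ suc n) 0)) (toℚᵘ-fromℚᵘ (ℚᵘ.mkℚᵘ 1ℤ n)) ⟩
  ℚᵘ.mkℚᵘ (ℤ.+ suc n) 0 ℚᵘ.* ℚᵘ.mkℚᵘ 1ℤ n
    ≈⟨ ℚᵘ.*≡* (trans (ℤₚ.*-identityʳ _) (trans (ℤₚ.*-identityʳ _)
        (sym (trans (ℤₚ.*-identityˡ _) (cong (λ k → ℤ.+ suc k) (ℕₚ.+-identityʳ n)))))) ⟩
  ℚᵘ.1ℚᵘ                                             ∎)
  where open ℚᵘₚ.≃-Reasoning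

sum : ℕ → (ℕ → ℚ) → ℚ
sum zero    f = 0ℚ
sum (suc n) f = sum n f + f n

sum-cong< : ∀ n {f g : ℕ → ℚ} → (∀ {i} → i < n → f i ≡ g i) → sum n f ≡ sum n g
sum-cong< zero    eq = refl
sum-cong< (suc n) eq = cong₂ _+_ (sum-cong< n (eq ∘ ℕₚ.m≤n⇒m≤1+n)) (eq ℕₚ.≤-refl)

sum-cong : ∀ n {f g : ℕ → ℚ} → (∀ i → f i ≡ g i) → sum n f ≡ sum n g
sum-cong n eq = sum-cong< n (λ {i} _ → eq i)

sum-zero : ∀ n {f : ℕ → ℚ} → (∀ i → f i ≡ 0ℚ) → sum n f ≡ 0ℚ
sum-zero zero    eq = refl
sum-zero (suc n) eq = cong₂ _+_ (sum-zero n eq) (eq n)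

sum-+ : ∀ n (f g : ℕ → ℚ) → sum n (λ i → f i + g i) ≡ sum n f + sum n g
sum-+ zero    f g = refl
sum-+ (suc n) f g = trans (cong (_+ (f n + g n)) (sum-+ n f g)) (medial (sum n f) (sum n g) (f n) (g n))
  where
  medial : ∀ a b c d → (a + b) + (c + d) ≡ (a + c) + (b + d)
  medial = solve-∀ ℚ-ring

sum-*ˡ : ∀ n c (f : ℕ → ℚ) → sum n (λ i → c * f i) ≡ c * sum n f
sum-*ˡ zero    c f = sym (*-zeroʳ c)
sum-*ˡ (suc n) c f = trans (cong (_+ c * f n) (sum-*ˡ n c f)) (sym (*-distribˡ-+ c (sum n f) (f n)))

sum-*ʳ : ∀ n c (f : ℕ → ℚ) → sum n (λ i → f i * c) ≡ sum n f * c
sum-*ʳ n c f = trans (sum-cong n (λ i → *-comm (f i) c)) (trans (sum-*ˡ n c f) (*-comm c _))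

sum-- : ∀ n (f g : ℕ → ℚ) → sum n (λ i → f i - g i) ≡ sum n f - sum n g
sum-- zero    f g = refl
sum-- (suc n) f g = trans (cong (_+ (f n - g n)) (sum-- n f g)) (medial (sum n f) (sum n g) (f n) (g n))
  where
  medial : ∀ a b c d → (a - b) + (c - d) ≡ (a + c) - (b + d)
  medial = solve-∀ ℚ-ring

sum-swap : ∀ m n (f : ℕ → ℕ → ℚ) →
  sum m (λ i → sum n (λ j → f i j)) ≡ sum n (λ j → sum m (λ i → f i j))
sum-swap zero    n f = sym (sum-zero n (λ _ → refl))
sum-swap (suc m) n f = trans (cong (_+ sum n (f m)) (sum-swap m n f))
  (sym (sum-+ n (λ j → sum m (λ i → f i j)) (f m)))

sum-front : ∀ n (f : ℕ → ℚ) → sum (suc n) f ≡ f 0 + sum n (f ∘ suc)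
sum-front zero    f = +-comm 0ℚ (f 0)
sum-front (suc n) f = trans (cong (_+ f (suc n)) (sum-front n f)) (+-assoc (f 0) _ _)

bin : ℕ → ℕ → ℚ
bin m       zero    = 1ℚ
bin zero    (suc n) = 0ℚ
bin (suc m) (suc n) = bin m n + bin m (suc n)

-- The reciprocal of `bin m n`, that is n!(m - n)!/m!, for n ≤ m, and 0 for n > m. The recursion is
-- the absorption identity inverted, so no division by a binomial coefficient occurs.
bin⁻¹ : ℕ → ℕ → ℚ
bin⁻¹ m       zero    = 1ℚ
bin⁻¹ zero    (suc n) = 0ℚ
bin⁻¹ (suc m) (suc n) = ⟦ suc n ⟧ * recip (suc m) * bin⁻¹ m n

bin-absorb : ∀ m n → ⟦ suc n ⟧ * bin (suc m) (suc n) ≡ ⟦ suc m ⟧ * bin m n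
bin-step : ∀ m n → ⟦ suc n ⟧ * bin m (suc n) ≡ (⟦ m ⟧ - ⟦ n ⟧) * bin m n

bin-absorb m n = trans (*-distribˡ-+ ⟦ suc n ⟧ (bin m n) (bin m (suc n)))
  (trans (cong (⟦ suc n ⟧ * bin m n +_) (bin-step m n)) (alg ⟦ n ⟧ ⟦ m ⟧ (bin m n)))
  where
  alg : ∀ n m b → (1ℚ + n) * b + (m - n) * b ≡ (1ℚ + m) * b
  alg = solve-∀ ℚ-ring

bin-step zero    zero    = refl
bin-step zero    (suc n) = trans (*-zeroʳ ⟦ suc (suc n) ⟧) (sym (*-zeroʳ (0ℚ - ⟦ suc n ⟧)))
bin-step (suc m) zero    = trans (alg (bin m 1)) (trans (cong (1ℚ +_) (bin-step m 0)) (alg′ ⟦ m ⟧))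
  where
  alg : ∀ b → (1ℚ + 0ℚ) * (1ℚ + b) ≡ 1ℚ + (1ℚ + 0ℚ) * b
  alg = solve-∀ ℚ-ring
  alg′ : ∀ m → 1ℚ + (m - 0ℚ) * 1ℚ ≡ ((1ℚ + m) - 0ℚ) * 1ℚ
  alg′ = solve-∀ ℚ-ring
bin-step (suc m) (suc n) = begin
  (1ℚ + sn) * (b₁ + b₂)                 ≡⟨ alg sn b₁ b₂ ⟩
  sn * b₁ + b₁ + (1ℚ + sn) * b₂         ≡⟨ cong₂ (λ s t → s + b₁ + t) (bin-step m n) (bin-step m (suc n)) ⟩
  (⟦ m ⟧ - ⟦ n ⟧) * bin m n + b₁ + (⟦ m ⟧ - sn) * b₁ ≡⟨ alg′ ⟦ m ⟧ ⟦ n ⟧ (bin m n) b₁ ⟩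
  ((1ℚ + ⟦ m ⟧) - sn) * (bin m n + b₁)  ∎
  where
  open ≡-Reasoning
  sn = ⟦ suc n ⟧
  b₁ = bin m (suc n)
  b₂ = bin m (suc (suc n))
  alg : ∀ s b c → (1ℚ + s) * (b + c) ≡ s * b + b + (1ℚ + s) * c
  alg = solve-∀ ℚ-ring
  alg′ : ∀ m n b c → (m - n) * b + c + (m - (1ℚ + n)) * c ≡ ((1ℚ + m) - (1ℚ + n)) * (b + c)
  alg′ = solve-∀ ℚ-ring

bin-> : ∀ {m n} → m < n → bin m n ≡ 0ℚ
bin-> {zero}  {suc n} _         = refl
bin-> {suc m} {suc n} (s≤s m<n) = cong₂ _+_ (bin-> m<n) (bin-> (ℕₚ.m≤n⇒m≤1+n m<n))

-- The connector

1*-elim : ∀ {u} → u ≡ 1ℚ → ∀ v → u * v ≡ v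
1*-elim u≡1 v = trans (cong (_* v) u≡1) (*-identityˡ v)

bin-suc-suc : ∀ m n → bin (suc m) (suc n) ≡ ⟦ suc m ⟧ * recip (suc n) * bin m n
bin-suc-suc m n = trans (sym (1*-elim (⟦⟧*recip n) _))
  (trans (left ⟦ suc n ⟧ (recip (suc n)) (bin (suc m) (suc n)))
    (trans (cong (recip (suc n) *_) (bin-absorb m n)) (right (recip (suc n)) ⟦ suc m ⟧ (bin m n))))
  where
  left : ∀ s r b → s * r * b ≡ r * (s * b)
  left = solve-∀ ℚ-ring
  right : ∀ r k b → r * (k * b) ≡ k * r * b
  right = solve-∀ ℚ-ring

bin-suc : ∀ m n → bin m (suc n) ≡ recip (suc n) * ((⟦ m ⟧ - ⟦ n ⟧) * bin m n)
bin-suc m n = trans (sym (1*-elim (⟦⟧*recip n) _))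
  (trans (left ⟦ suc n ⟧ (recip (suc n)) (bin m (suc n))) (cong (recip (suc n) *_) (bin-step m n)))
  where
  left : ∀ s r b → s * r * b ≡ r * (s * b)
  left = solve-∀ ℚ-ring

bin⁻¹-suc : ∀ {m n} → n ≤ m → ⟦ suc m ⟧ * bin⁻¹ (suc m) n ≡ (⟦ suc m ⟧ - ⟦ n ⟧) * bin⁻¹ m n
bin⁻¹-suc {m} z≤n = cong (_* 1ℚ) (sym (+-identityʳ ⟦ suc m ⟧))
bin⁻¹-suc {suc m} {suc n} (s≤s n≤m) = begin
  k₂ * (s * recip (suc (suc m)) * bin⁻¹ (suc m) n)    ≡⟨ alg k₂ s (recip (suc (suc m))) _ ⟩
  k₂ * recip (suc (suc m)) * (s * bin⁻¹ (suc m) n)    ≡⟨ 1*-elim (⟦⟧*recip (suc m)) _ ⟩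
  s * bin⁻¹ (suc m) n                                 ≡⟨ 1*-elim (⟦⟧*recip m) _ ⟨
  k₁ * r₁ * (s * bin⁻¹ (suc m) n)                     ≡⟨ alg₂ k₁ r₁ s _ ⟩
  s * r₁ * (k₁ * bin⁻¹ (suc m) n)                     ≡⟨ cong (s * r₁ *_) (bin⁻¹-suc n≤m) ⟩
  s * r₁ * ((k₁ - ⟦ n ⟧) * bin⁻¹ m n)                 ≡⟨ alg₃ k₁ r₁ ⟦ n ⟧ (bin⁻¹ m n) ⟩
  (k₂ - s) * (s * r₁ * bin⁻¹ m n)                     ∎
  where
  open ≡-Reasoning
  k₂ = ⟦ suc (suc m) ⟧
  k₁ = ⟦ suc m ⟧
  r₁ = recip (suc m)
  s = ⟦ suc n ⟧
  alg : ∀ k s r b → k * (s * r * b) ≡ k * r * (s * b)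
  alg = solve-∀ ℚ-ring
  alg₂ : ∀ k r s b → k * r * (s * b) ≡ s * r * (k * b)
  alg₂ = solve-∀ ℚ-ring
  alg₃ : ∀ k r n b → (1ℚ + n) * r * ((k - n) * b) ≡ ((1ℚ + k) - (1ℚ + n)) * ((1ℚ + n) * r * b)
  alg₃ = solve-∀ ℚ-ring

conn : ℕ → ℕ → ℕ → ℚ
conn K m n = bin K (m ℕ.+ n) * bin⁻¹ K m * bin⁻¹ K n

conn-comm : ∀ K m n → conn K m n ≡ conn K n m
conn-comm K m n = trans (cong (λ t → bin K t * bin⁻¹ K m * bin⁻¹ K n) (ℕₚ.+-comm m n))
  (alg (bin K (n ℕ.+ m)) (bin⁻¹ K m) (bin⁻¹ K n))
  where
  alg : ∀ a b c → a * b * c ≡ a * c * b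
  alg = solve-∀ ℚ-ring

conn-> : ∀ {K m} n → K < m → conn K m n ≡ 0ℚ
conn-> {K} {m} n K<m = trans
  (cong (λ t → t * bin⁻¹ K m * bin⁻¹ K n) (bin-> (ℕₚ.≤-trans K<m (ℕₚ.m≤m+n m n))))
  (alg (bin⁻¹ K m) (bin⁻¹ K n))
  where
  alg : ∀ b c → 0ℚ * b * c ≡ 0ℚ
  alg = solve-∀ ℚ-ring

-- `bin⁻¹-suc` fails at m = K + 1, where the reciprocal on the left is 1 and the right side is 0.
-- Every use has a factor `bin K (m + n)`, which vanishes for all m > K and restores the identity
-- there.
bin*bin⁻¹-suc : ∀ K m n →
  bin K (m ℕ.+ n) * (⟦ suc K ⟧ * bin⁻¹ (suc K) m) ≡ bin K (m ℕ.+ n) * ((⟦ suc K ⟧ - ⟦ m ⟧) * bin⁻¹ K m)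
bin*bin⁻¹-suc K m n with ℕₚ.≤-<-connex m K
... | inj₁ m≤K = cong (bin K (m ℕ.+ n) *_) (bin⁻¹-suc m≤K)
... | inj₂ K<m rewrite bin-> (ℕₚ.≤-trans K<m (ℕₚ.m≤m+n m n)) = trans
    (*-zeroˡ (⟦ suc K ⟧ * bin⁻¹ (suc K) m)) (sym (*-zeroˡ ((⟦ suc K ⟧ - ⟦ m ⟧) * bin⁻¹ K m)))

-- Up to this common factor, all increments of conn are monomials in m + 1, n + 1 and K + 1.
connE : ℕ → ℕ → ℕ → ℚ
connE zero    m n = 0ℚ
connE (suc K) m n = recip (suc (m ℕ.+ n)) * recip (suc (suc (m ℕ.+ n))) * recip (suc K) * conn K m n

conn-suc-suc : ∀ K m n →
  conn K (suc m) (suc n) ≡ ⟦ suc m ⟧ * ⟦ suc n ⟧ * ((⟦ suc K ⟧ - ⟦ suc m ⟧) - ⟦ suc n ⟧) * connE K m n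
conn-suc-suc zero m n = trans (alg (bin⁻¹ 0 (suc m)) (bin⁻¹ 0 (suc n)))
  (sym (*-zeroʳ (⟦ suc m ⟧ * ⟦ suc n ⟧ * ((⟦ 1 ⟧ - ⟦ suc m ⟧) - ⟦ suc n ⟧))))
  where
  alg : ∀ b c → 0ℚ * b * c ≡ 0ℚ
  alg = solve-∀ ℚ-ring
conn-suc-suc (suc K) m n = begin
  bin (suc K) (suc (m ℕ.+ suc n)) * (α * r₁ * p) * (β * r₁ * q)
    ≡⟨ cong (λ t → bin (suc K) (suc t) * (α * r₁ * p) * (β * r₁ * q)) (ℕₚ.+-suc m n) ⟩
  bin (suc K) (suc (suc (m ℕ.+ n))) * (α * r₁ * p) * (β * r₁ * q)
    ≡⟨ cong (λ t → t * (α * r₁ * p) * (β * r₁ * q))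
        (trans (bin-suc-suc K (suc (m ℕ.+ n))) (cong (k₁ * s₂ *_) (bin-suc K (m ℕ.+ n)))) ⟩
  (k₁ * s₂ * (s₁ * ((⟦ K ⟧ - ⟦ m ℕ.+ n ⟧) * u))) * (α * r₁ * p) * (β * r₁ * q)
    ≡⟨ cong (λ t → (k₁ * s₂ * (s₁ * ((⟦ K ⟧ - t) * u))) * (α * r₁ * p) * (β * r₁ * q)) (⟦⟧-+ m n) ⟩
  (k₁ * s₂ * (s₁ * ((⟦ K ⟧ - (⟦ m ⟧ + ⟦ n ⟧)) * u))) * (α * r₁ * p) * (β * r₁ * q)
    ≡⟨ alg ⟦ K ⟧ ⟦ m ⟧ ⟦ n ⟧ s₁ s₂ r₁ u p q ⟩
  k₁ * r₁ * (α * β * ((⟦ suc (suc K) ⟧ - α) - β) * (s₁ * s₂ * r₁ * (u * p * q)))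
    ≡⟨ 1*-elim (⟦⟧*recip K) _ ⟩
  α * β * ((⟦ suc (suc K) ⟧ - α) - β) * (s₁ * s₂ * r₁ * (u * p * q)) ∎
  where
  open ≡-Reasoning
  α = ⟦ suc m ⟧
  β = ⟦ suc n ⟧
  k₁ = ⟦ suc K ⟧
  r₁ = recip (suc K)
  s₁ = recip (suc (m ℕ.+ n))
  s₂ = recip (suc (suc (m ℕ.+ n)))
  u = bin K (m ℕ.+ n)
  p = bin⁻¹ K m
  q = bin⁻¹ K n
  alg : ∀ K m n s₁ s₂ r₁ u p q →
    ((1ℚ + K) * s₂ * (s₁ * ((K - (m + n)) * u))) * ((1ℚ + m) * r₁ * p) * ((1ℚ + n) * r₁ * q) ≡
    (1ℚ + K) * r₁ * ((1ℚ + m) * (1ℚ + n) * (((1ℚ + (1ℚ + K)) - (1ℚ + m)) - (1ℚ + n)) *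
        (s₁ * s₂ * r₁ * (u * p * q)))
  alg = solve-∀ ℚ-ring

conn-Δˡ : ∀ K m n →
  conn K m (suc n) - conn K (suc m) (suc n) ≡ ⟦ suc n ⟧ * ⟦ suc n ⟧ * ⟦ suc K ⟧ * connE K m n
conn-Δˡ zero m n rewrite ℕₚ.+-suc m n = alg (bin⁻¹ 0 m) (⟦ suc n ⟧ * ⟦ suc n ⟧ * ⟦ 1 ⟧)
  where
  alg : ∀ b c → 0ℚ * b * 0ℚ - 0ℚ * 0ℚ * 0ℚ ≡ c * 0ℚ
  alg = solve-∀ ℚ-ring
conn-Δˡ (suc K) m n = begin
  conn (suc K) m (suc n) - conn (suc K) (suc m) (suc n)
    ≡⟨ cong₂ _-_ first (conn-suc-suc (suc K) m n) ⟩
  s₂ * (α + β) * (s₁ * β * r₁ * q * (u * ((k₁ - ⟦ m ⟧) * p))) - α * β * ((⟦ suc (suc K) ⟧ - α) - β) *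
      (s₁ * s₂ * r₁ * (u * p * q))
    ≡⟨ alg ⟦ K ⟧ ⟦ m ⟧ ⟦ n ⟧ s₁ s₂ r₁ u p q ⟩
  β * β * ⟦ suc (suc K) ⟧ * (s₁ * s₂ * r₁ * (u * p * q)) ∎
  where
  open ≡-Reasoning
  α = ⟦ suc m ⟧
  β = ⟦ suc n ⟧
  k₁ = ⟦ suc K ⟧
  r₁ = recip (suc K)
  s₁ = recip (suc (m ℕ.+ n))
  s₂ = recip (suc (suc (m ℕ.+ n)))
  u = bin K (m ℕ.+ n)
  p = bin⁻¹ K m
  P = bin⁻¹ (suc K) m
  q = bin⁻¹ K n
  -- α + β is m + n + 2. Inserting this 1 gives both terms the denominators of `connE`, after which
  -- the difference is a polynomial identity.
  s₂-unit : s₂ * (α + β) ≡ 1ℚ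
  s₂-unit = trans (*-comm s₂ (α + β)) (trans (cong (_* s₂)
    (trans (assoc ⟦ m ⟧ ⟦ n ⟧) (cong (λ t → 1ℚ + (1ℚ + t)) (sym (⟦⟧-+ m n))))) (⟦⟧*recip (suc (m ℕ.+ n))))
    where
    assoc : ∀ m n → (1ℚ + m) + (1ℚ + n) ≡ 1ℚ + (1ℚ + (m + n))
    assoc = solve-∀ ℚ-ring
  reorder : ∀ k₁ s₁ u P β r₁ q → (k₁ * s₁ * u) * P * (β * r₁ * q) ≡ s₁ * β * r₁ * q * (u * (k₁ * P))
  reorder = solve-∀ ℚ-ring
  first : conn (suc K) m (suc n) ≡ s₂ * (α + β) * (s₁ * β * r₁ * q * (u * ((k₁ - ⟦ m ⟧) * p)))
  first = begin
    bin (suc K) (m ℕ.+ suc n) * P * (β * r₁ * q)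
      ≡⟨ cong (λ t → bin (suc K) t * P * (β * r₁ * q)) (ℕₚ.+-suc m n) ⟩
    bin (suc K) (suc (m ℕ.+ n)) * P * (β * r₁ * q)
      ≡⟨ cong (λ t → t * P * (β * r₁ * q)) (bin-suc-suc K (m ℕ.+ n)) ⟩
    (k₁ * s₁ * u) * P * (β * r₁ * q)                ≡⟨ reorder k₁ s₁ u P β r₁ q ⟩
    s₁ * β * r₁ * q * (u * (k₁ * P))                ≡⟨ cong (s₁ * β * r₁ * q *_) (bin*bin⁻¹-suc K m n) ⟩
    s₁ * β * r₁ * q * (u * ((k₁ - ⟦ m ⟧) * p))      ≡⟨ 1*-elim s₂-unit _ ⟨
    s₂ * (α + β) * (s₁ * β * r₁ * q * (u * ((k₁ - ⟦ m ⟧) * p))) ∎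
  alg : ∀ K m n s₁ s₂ r₁ u p q →
    s₂ * ((1ℚ + m) + (1ℚ + n)) * (s₁ * (1ℚ + n) * r₁ * q * (u * (((1ℚ + K) - m) * p)))
      - (1ℚ + m) * (1ℚ + n) * (((1ℚ + (1ℚ + K)) - (1ℚ + m)) - (1ℚ + n)) * (s₁ * s₂ * r₁ * (u * p * q))
    ≡ (1ℚ + n) * (1ℚ + n) * (1ℚ + (1ℚ + K)) * (s₁ * s₂ * r₁ * (u * p * q))
  alg = solve-∀ ℚ-ring

connE-comm : ∀ K m n → connE K m n ≡ connE K n m
connE-comm zero    m n = refl
connE-comm (suc K) m n = cong₂ (λ t v → recip (suc t) * recip (suc (suc t)) * recip (suc K) * v)
  (ℕₚ.+-comm m n) (conn-comm K m n)

conn-Δʳ : ∀ K m n →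
  conn K (suc m) n - conn K (suc m) (suc n) ≡ ⟦ suc m ⟧ * ⟦ suc m ⟧ * ⟦ suc K ⟧ * connE K m n
conn-Δʳ K m n = trans (cong₂ _-_ (conn-comm K (suc m) n) (conn-comm K (suc m) (suc n)))
  (trans (conn-Δˡ K n m) (cong (⟦ suc m ⟧ * ⟦ suc m ⟧ * ⟦ suc K ⟧ *_) (connE-comm K n m)))

conn-ΔK : ∀ K m n → conn (suc K) (suc m) (suc n) - conn K (suc m) (suc n) ≡
  ⟦ suc m ⟧ * ⟦ suc m ⟧ * (⟦ suc n ⟧ * ⟦ suc n ⟧) * recip (suc K) * connE K m n
conn-ΔK zero m n rewrite ℕₚ.+-suc m n =
  alg (bin⁻¹ 1 (suc m)) (bin⁻¹ 1 (suc n)) (⟦ suc m ⟧ * ⟦ suc m ⟧ * (⟦ suc n ⟧ * ⟦ suc n ⟧) * recip 1)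
  where
  alg : ∀ b c d → (0ℚ + 0ℚ) * b * c - 0ℚ * 0ℚ * 0ℚ ≡ d * 0ℚ
  alg = solve-∀ ℚ-ring
conn-ΔK (suc K) m n = begin
  conn (suc (suc K)) (suc m) (suc n) - conn (suc K) (suc m) (suc n)
    ≡⟨ cong₂ _-_ first (trans (conn-suc-suc (suc K) m n) (sym (1*-elim (⟦⟧*recip (suc K)) _))) ⟩
  s₁ * s₂ * α * β * r₂ * r₁ * ((k₁ - ⟦ n ⟧) * q * (u * ((k₁ - ⟦ m ⟧) * p)))
    - k₂ * r₂ * (α * β * ((k₂ - α) - β) * (s₁ * s₂ * r₁ * (u * p * q)))
    ≡⟨ alg ⟦ K ⟧ ⟦ m ⟧ ⟦ n ⟧ s₁ s₂ r₁ r₂ u p q ⟩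
  α * α * (β * β) * r₂ * (s₁ * s₂ * r₁ * (u * p * q)) ∎
  where
  open ≡-Reasoning
  α = ⟦ suc m ⟧
  β = ⟦ suc n ⟧
  k₁ = ⟦ suc K ⟧
  k₂ = ⟦ suc (suc K) ⟧
  r₁ = recip (suc K)
  r₂ = recip (suc (suc K))
  s₁ = recip (suc (m ℕ.+ n))
  s₂ = recip (suc (suc (m ℕ.+ n)))
  u = bin K (m ℕ.+ n)
  p = bin⁻¹ K m
  P = bin⁻¹ (suc K) m
  q = bin⁻¹ K n
  Q = bin⁻¹ (suc K) n
  reorder : ∀ k₂ s₂ k₁ s₁ u α r₂ P β Q → (k₂ * s₂ * (k₁ * s₁ * u)) * (α * r₂ * P) * (β * r₂ * Q) ≡
    k₂ * r₂ * (s₁ * s₂ * α * β * r₂ * (Q * (u * (k₁ * P))))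
  reorder = solve-∀ ℚ-ring
  reorder₂ : ∀ k₁ r₁ c Q u v p → k₁ * r₁ * (c * (Q * (u * (v * p)))) ≡ c * r₁ * (v * p * (u * (k₁ * Q)))
  reorder₂ = solve-∀ ℚ-ring
  reorder₃ : ∀ v p u w q → v * p * (u * (w * q)) ≡ w * q * (u * (v * p))
  reorder₃ = solve-∀ ℚ-ring
  swapped : u * (k₁ * Q) ≡ u * ((k₁ - ⟦ n ⟧) * q)
  swapped = trans (cong (λ t → bin K t * (k₁ * Q)) (ℕₚ.+-comm m n))
    (trans (bin*bin⁻¹-suc K n m) (cong (λ t → bin K t * ((k₁ - ⟦ n ⟧) * q)) (ℕₚ.+-comm n m)))
  first : conn (suc (suc K)) (suc m) (suc n) ≡
    s₁ * s₂ * α * β * r₂ * r₁ * ((k₁ - ⟦ n ⟧) * q * (u * ((k₁ - ⟦ m ⟧) * p)))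
  first = begin
    bin (suc (suc K)) (suc (m ℕ.+ suc n)) * (α * r₂ * P) * (β * r₂ * Q)
      ≡⟨ cong (λ t → bin (suc (suc K)) (suc t) * (α * r₂ * P) * (β * r₂ * Q)) (ℕₚ.+-suc m n) ⟩
    bin (suc (suc K)) (suc (suc (m ℕ.+ n))) * (α * r₂ * P) * (β * r₂ * Q)
      ≡⟨ cong (λ t → t * (α * r₂ * P) * (β * r₂ * Q))
          (trans (bin-suc-suc (suc K) (suc (m ℕ.+ n))) (cong (k₂ * s₂ *_) (bin-suc-suc K (m ℕ.+ n)))) ⟩
    (k₂ * s₂ * (k₁ * s₁ * u)) * (α * r₂ * P) * (β * r₂ * Q)
      ≡⟨ reorder k₂ s₂ k₁ s₁ u α r₂ P β Q ⟩
    k₂ * r₂ * (s₁ * s₂ * α * β * r₂ * (Q * (u * (k₁ * P))))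
      ≡⟨ 1*-elim (⟦⟧*recip (suc K)) _ ⟩
    c * (Q * (u * (k₁ * P)))                  ≡⟨ cong (λ t → c * (Q * t)) (bin*bin⁻¹-suc K m n) ⟩
    c * (Q * (u * ((k₁ - ⟦ m ⟧) * p)))        ≡⟨ 1*-elim (⟦⟧*recip K) _ ⟨
    k₁ * r₁ * (c * (Q * (u * ((k₁ - ⟦ m ⟧) * p)))) ≡⟨ reorder₂ k₁ r₁ c Q u (k₁ - ⟦ m ⟧) p ⟩
    c * r₁ * ((k₁ - ⟦ m ⟧) * p * (u * (k₁ * Q)))   ≡⟨ cong (λ t → c * r₁ * ((k₁ - ⟦ m ⟧) * p * t)) swapped ⟩
    c * r₁ * ((k₁ - ⟦ m ⟧) * p * (u * ((k₁ - ⟦ n ⟧) * q)))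
      ≡⟨ cong (c * r₁ *_) (reorder₃ (k₁ - ⟦ m ⟧) p u (k₁ - ⟦ n ⟧) q) ⟩
    c * r₁ * ((k₁ - ⟦ n ⟧) * q * (u * ((k₁ - ⟦ m ⟧) * p))) ∎
    where c = s₁ * s₂ * α * β * r₂
  alg : ∀ K m n s₁ s₂ r₁ r₂ u p q →
    s₁ * s₂ * (1ℚ + m) * (1ℚ + n) * r₂ * r₁ * (((1ℚ + K) - n) * q * (u * (((1ℚ + K) - m) * p)))
    - (1ℚ + (1ℚ + K)) * r₂ * ((1ℚ + m) * (1ℚ + n) * (((1ℚ + (1ℚ + K)) - (1ℚ + m)) - (1ℚ + n)) *
        (s₁ * s₂ * r₁ * (u * p * q)))
    ≡ (1ℚ + m) * (1ℚ + m) * ((1ℚ + n) * (1ℚ + n)) * r₂ * (s₁ * s₂ * r₁ * (u * p * q))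
  alg = solve-∀ ℚ-ring

conn-suc-0 : ∀ K m → conn (suc K) (suc m) 0 ≡ conn K m 0
conn-suc-0 K m rewrite ℕₚ.+-identityʳ m = begin
  bin (suc K) (suc m) * (⟦ suc m ⟧ * rK * bin⁻¹ K m) * 1ℚ
    ≡⟨ cong (λ t → t * (⟦ suc m ⟧ * rK * bin⁻¹ K m) * 1ℚ) (bin-suc-suc K m) ⟩
  (⟦ suc K ⟧ * rm * bin K m) * (⟦ suc m ⟧ * rK * bin⁻¹ K m) * 1ℚ
    ≡⟨ alg ⟦ suc K ⟧ rm (bin K m) ⟦ suc m ⟧ rK (bin⁻¹ K m) ⟩
  ⟦ suc K ⟧ * rK * (⟦ suc m ⟧ * rm * (bin K m * bin⁻¹ K m * 1ℚ))
    ≡⟨ trans (1*-elim (⟦⟧*recip K) _) (1*-elim (⟦⟧*recip m) _) ⟩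
  bin K m * bin⁻¹ K m * 1ℚ ∎
  where
  open ≡-Reasoning
  rK = recip (suc K)
  rm = recip (suc m)
  alg : ∀ k r b s t c → (k * r * b) * (s * t * c) * 1ℚ ≡ k * t * (s * r * (b * c * 1ℚ))
  alg = solve-∀ ℚ-ring

-- conn K m 0 is 1 for m ≤ K and 0 for m > K, so the difference below lives at m = K.
conn-jump : ∀ (f : ℕ → ℚ) K m →
  f m * (conn K m 0 - conn K (suc m) 0) ≡ f K * (conn K m 0 - conn K (suc m) 0)
conn-jump f zero    zero    = refl
conn-jump f zero    (suc m) = alg (f (suc m)) (f 0) (bin⁻¹ 0 (suc m))
  where
  alg : ∀ a b c → a * (0ℚ * 0ℚ * 1ℚ - 0ℚ * 0ℚ * 1ℚ) ≡ b * (0ℚ * 0ℚ * 1ℚ - 0ℚ * 0ℚ * 1ℚ)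
  alg = solve-∀ ℚ-ring
conn-jump f (suc K) zero    = trans (cong (λ t → f 0 * (1ℚ - t)) eq)
    (trans (alg (f 0) (f (suc K))) (cong (λ t → f (suc K) * (1ℚ - t)) (sym eq)))
  where
  eq : conn (suc K) 1 0 ≡ 1ℚ
  eq = conn-suc-0 K 0
  alg : ∀ a b → a * (1ℚ - 1ℚ) ≡ b * (1ℚ - 1ℚ)
  alg = solve-∀ ℚ-ring
conn-jump f (suc K) (suc m) = begin
  f (suc m) * (conn (suc K) (suc m) 0 - conn (suc K) (suc (suc m)) 0)  ≡⟨ cong (f (suc m) *_) eq ⟩
  f (suc m) * (conn K m 0 - conn K (suc m) 0)                          ≡⟨ conn-jump (f ∘ suc) K m ⟩
  f (suc K) * (conn K m 0 - conn K (suc m) 0)                          ≡⟨ cong (f (suc K) *_) eq ⟨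
  f (suc K) * (conn (suc K) (suc m) 0 - conn (suc K) (suc (suc m)) 0)  ∎
  where
  open ≡-Reasoning
  eq = cong₂ _-_ (conn-suc-0 K m) (conn-suc-0 K (suc m))

-- Both differences are the indicator of m = K, so any weight at m + 1 may be read at K + 1. This
-- freedom in f is special to second index 0; it yields squares for z₂ and cubes for z₃ alike.
conn-jump-K : ∀ (f : ℕ → ℚ) K m → f (suc m) * (conn (suc K) (suc m) 0 - conn K (suc m) 0) ≡
  f (suc K) * (conn K m 0 - conn K (suc m) 0)
conn-jump-K f K m = trans (cong (λ t → f (suc m) * (t - conn K (suc m) 0)) (conn-suc-0 K m))
  (conn-jump (f ∘ suc) K m)

-- Trading weights in the summation indices for weights in K + 1

sq : ℕ → ℚ
sq n = recip n * recip n

-- For a positive second index β, the formulas for the increments make both sides β² E / (K + 1)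
-- with E the common factor `connE`: the weight cancels exactly the square of m + 1. Second index 0
-- lies outside those formulas and is the jump case.
conn-z₂ : ∀ K m n → sq (suc m) * (conn (suc K) (suc m) n - conn K (suc m) n) ≡
  sq (suc K) * (conn K m n - conn K (suc m) n)
conn-z₂ K m zero    = conn-jump-K sq K m
conn-z₂ K m (suc n) = begin
  r * r * (conn (suc K) (suc m) (suc n) - conn K (suc m) (suc n))  ≡⟨ cong (r * r *_) (conn-ΔK K m n) ⟩
  r * r * (α * α * (β * β) * s * e)       ≡⟨ alg r α β s e ⟩
  α * r * (α * r * (β * β * s * e))       ≡⟨ trans (1*-elim (⟦⟧*recip m) _) (1*-elim (⟦⟧*recip m) _) ⟩
  β * β * s * e                           ≡⟨ 1*-elim (⟦⟧*recip K) _ ⟨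
  k * s * (β * β * s * e)                 ≡⟨ alg₂ k s β e ⟩
  s * s * (β * β * k * e)                 ≡⟨ cong (s * s *_) (conn-Δˡ K m n) ⟨
  s * s * (conn K m (suc n) - conn K (suc m) (suc n)) ∎
  where
  open ≡-Reasoning
  α = ⟦ suc m ⟧
  β = ⟦ suc n ⟧
  k = ⟦ suc K ⟧
  r = recip (suc m)
  s = recip (suc K)
  e = connE K m n
  alg : ∀ r α β s e → r * r * (α * α * (β * β) * s * e) ≡ α * r * (α * r * (β * β * s * e))
  alg = solve-∀ ℚ-ring
  alg₂ : ∀ k s β e → k * s * (β * β * s * e) ≡ s * s * (β * β * k * e)
  alg₂ = solve-∀ ℚ-ring

-- On power series coefficients, integration from 0 against dt/t and dt/(1 - t). The value 0 at
-- index 0 (for `opX` through the default `recip 0` = 0) is the vanishing constant term of such an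
-- integral.
opX opY : (ℕ → ℚ) → ℕ → ℚ
opX a n       = recip n * a n
opY a zero    = 0ℚ
opY a (suc n) = recip (suc n) * sum (suc n) a

opz₂ opz₃ : (ℕ → ℚ) → ℕ → ℚ
opz₂ a = opX (opY a)
opz₃ a = opX (opX (opY a))

coef : Word²³ → ℕ → ℚ
coef ε zero    = 1ℚ
coef ε (suc n) = 0ℚ
coef (w z₂)    = opz₂ (coef w)
coef (w z₃)    = opz₃ (coef w)

-- Write α, β, N for m + 1, n + 1, K + 1. In terms of E = `connE K m n` the left side is A B E / (α
-- β N), and the three terms on the right are A B E / (α β N²) times α, β and N - α - β. A and B
-- stand for the partial sums inside `opY`.
conn-z₃ : ∀ K m n A B →
  let r = recip (suc m); s = recip (suc n); k = recip (suc K) in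
  r * (r * (r * A)) * (s * (s * (s * B)) * (conn (suc K) (suc m) (suc n) - conn K (suc m) (suc n))) ≡
  (k * k * k) * (A * (s * (s * (s * B)) * (conn K m (suc n) - conn K (suc m) (suc n)))
    + r * (r * (r * A)) * (B * (conn K (suc m) n - conn K (suc m) (suc n))))
  + k * k * (r * (r * A) * (s * (s * B) * conn K (suc m) (suc n)))
conn-z₃ K m n A B = begin
  r * (r * (r * A)) * (s * (s * (s * B)) * (conn (suc K) (suc m) (suc n) - conn K (suc m) (suc n)))
    ≡⟨ cong (λ t → r * (r * (r * A)) * (s * (s * (s * B)) * t)) (conn-ΔK K m n) ⟩
  r * (r * (r * A)) * (s * (s * (s * B)) * (α * α * (β * β) * k * e))
    ≡⟨ collect r s α β k e A B ⟩
  (α * r) * ((α * r) * ((β * s) * ((β * s) * (r * s * A * B * e * k))))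
    ≡⟨ cancel⁴ _ ⟩
  r * s * A * B * e * k
    ≡⟨ 1*-elim (⟦⟧*recip K) _ ⟨
  N * k * (r * s * A * B * e * k)
    ≡⟨ split r s α β k e A B N ⟩
  k * k * (A * B * e * (r * s * (α + β + ((N - α) - β))))
    ≡⟨ regroup r s α β k e A B ((N - α) - β) ⟩
  k * k * (A * B * e * (s * (α * r) + r * (β * s))) + k * k * (A * B * e * (r * s * ((N - α) - β)))
    ≡⟨ cong (λ t → k * k * (A * B * e * t) + k * k * (A * B * e * (r * s * ((N - α) - β))))
         (cong₂ _+_ (trans (cong (s *_) (⟦⟧*recip m)) (*-identityʳ s))
             (trans (cong (r *_) (⟦⟧*recip n)) (*-identityʳ r))) ⟩
  k * k * (A * B * e * (s + r)) + k * k * (A * B * e * (r * s * ((N - α) - β)))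
    ≡⟨ cong₂ _+_ (sym left) (sym right) ⟩
  (k * k * k) * (A * (s * (s * (s * B)) * (β * β * N * e)) + r * (r * (r * A)) * (B * (α * α * N * e)))
    + k * k * (r * (r * A) * (s * (s * B) * (α * β * ((N - α) - β) * e)))
    ≡⟨ cong₂ _+_ (cong₂ (λ t u → (k * k * k) * (A * (s * (s * (s * B)) * t) + r * (r * (r * A)) * (B * u)))
         (sym (conn-Δˡ K m n)) (sym (conn-Δʳ K m n)))
         (cong (λ t → k * k * (r * (r * A) * (s * (s * B) * t))) (sym (conn-suc-suc K m n))) ⟩
  (k * k * k) * (A * (s * (s * (s * B)) * (conn K m (suc n) - conn K (suc m) (suc n)))
    + r * (r * (r * A)) * (B * (conn K (suc m) n - conn K (suc m) (suc n))))
  + k * k * (r * (r * A) * (s * (s * B) * conn K (suc m) (suc n))) ∎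
  where
  open ≡-Reasoning
  α = ⟦ suc m ⟧
  β = ⟦ suc n ⟧
  N = ⟦ suc K ⟧
  r = recip (suc m)
  s = recip (suc n)
  k = recip (suc K)
  e = connE K m n
  cancel⁴ : ∀ v → (α * r) * ((α * r) * ((β * s) * ((β * s) * v))) ≡ v
  cancel⁴ v = trans (1*-elim (⟦⟧*recip m) _) (trans (1*-elim (⟦⟧*recip m) _)
    (trans (1*-elim (⟦⟧*recip n) _) (1*-elim (⟦⟧*recip n) _)))
  collect : ∀ r s α β k e A B → r * (r * (r * A)) * (s * (s * (s * B)) * (α * α * (β * β) * k * e)) ≡
    (α * r) * ((α * r) * ((β * s) * ((β * s) * (r * s * A * B * e * k))))
  collect = solve-∀ ℚ-ring
  split : ∀ r s α β k e A B N → N * k * (r * s * A * B * e * k) ≡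
    k * k * (A * B * e * (r * s * (α + β + ((N - α) - β))))
  split = solve-∀ ℚ-ring
  regroup : ∀ r s α β k e A B d → k * k * (A * B * e * (r * s * (α + β + d))) ≡
    k * k * (A * B * e * (s * (α * r) + r * (β * s))) + k * k * (A * B * e * (r * s * d))
  regroup = solve-∀ ℚ-ring
  left₁ : ∀ r s α β k e A B N →
    (k * k * k) * (A * (s * (s * (s * B)) * (β * β * N * e)) + r * (r * (r * A)) * (B * (α * α * N * e))) ≡
    N * k * (k * k * (A * B * e * ((β * s) * ((β * s) * s) + (α * r) * ((α * r) * r))))
  left₁ = solve-∀ ℚ-ring
  left : (k * k * k) * (A * (s * (s * (s * B)) * (β * β * N * e)) + r * (r * (r * A)) *
      (B * (α * α * N * e))) ≡
    k * k * (A * B * e * (s + r))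
  left = trans (left₁ r s α β k e A B N) (trans (1*-elim (⟦⟧*recip K) _)
    (cong (λ t → k * k * (A * B * e * t)) (cong₂ _+_
      (trans (1*-elim (⟦⟧*recip n) _) (1*-elim (⟦⟧*recip n) _))
      (trans (1*-elim (⟦⟧*recip m) _) (1*-elim (⟦⟧*recip m) _)))))
  right₁ : ∀ r s α β k e A B d → k * k * (r * (r * A) * (s * (s * B) * (α * β * d * e))) ≡
    (α * r) * ((β * s) * (k * k * (A * B * e * (r * s * d))))
  right₁ = solve-∀ ℚ-ring
  right : k * k * (r * (r * A) * (s * (s * B) * (α * β * ((N - α) - β) * e))) ≡
    k * k * (A * B * e * (r * s * ((N - α) - β)))
  right = trans (right₁ r s α β k e A B ((N - α) - β))
    (trans (1*-elim (⟦⟧*recip m) _) (1*-elim (⟦⟧*recip n) _))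

-- Summation by parts.
abel : ∀ L (a h : ℕ → ℚ) →
  sum L (λ m → sum (suc m) a * (h m - h (suc m))) ≡ sum L (λ m → a m * h m) - sum L a * h L
abel zero    a h = sym (cong (λ t → 0ℚ - t) (*-zeroˡ (h 0)))
abel (suc L) a h = trans (cong (_+ sum (suc L) a * (h L - h (suc L))) (abel L a h))
  (alg (sum L (λ m → a m * h m)) (sum L a) (a L) (h L) (h (suc L)))
  where
  alg : ∀ S A a h h′ → S - A * h + (A + a) * (h - h′) ≡ S + a * h - (A + a) * h′
  alg = solve-∀ ℚ-ring

-- The vanishing of h at L removes both the boundary term of `abel` and the last summand on the
-- left.
abel-vanishing : ∀ L (a h : ℕ → ℚ) → h L ≡ 0ℚ →
  sum (suc L) (λ m → a m * h m) ≡ sum L (λ m → sum (suc m) a * (h m - h (suc m)))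
abel-vanishing L a h hL≡0 = trans
  (cong (λ t → sum L (λ m → a m * h m) + a L * t) hL≡0)
  (trans (alg (sum L (λ m → a m * h m)) (a L) (sum L a))
    (trans (cong (λ t → sum L (λ m → a m * h m) - sum L a * t) (sym hL≡0)) (sym (abel L a h))))
  where
  alg : ∀ S a A → S + a * 0ℚ ≡ S - A * 0ℚ
  alg = solve-∀ ℚ-ring

sum-drop : ∀ L (f : ℕ → ℚ) → f 0 ≡ 0ℚ → sum (suc L) f ≡ sum L (f ∘ suc)
sum-drop L f f0≡0 = trans (sum-front L f) (trans (cong (_+ sum L (f ∘ suc)) f0≡0) (+-identityˡ _))

-- Connected sums

-- The cut-off L is kept apart from K. Since the connector vanishes once an index exceeds K, every L
-- ≥ K gives the same sum; a common L lets T_{K+1} and T_K be subtracted term by term, and K < L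
-- supplies the vanishing at L for summation by parts.
row : ℕ → ℕ → (ℕ → ℚ) → ℕ → ℚ
row L K b m = sum (suc L) (λ n → b n * conn K m n)

pair : ℕ → ℕ → (ℕ → ℚ) → (ℕ → ℚ) → ℚ
pair L K a b = sum (suc L) (λ m → a m * row L K b m)

sum-linear : ∀ n c (f g h : ℕ → ℚ) → (∀ i → f i - g i ≡ c * h i) → sum n f - sum n g ≡ c * sum n h
sum-linear n c f g h eq = trans (sym (sum-- n f g)) (trans (sum-cong n eq) (sum-*ˡ n c h))

row-> : ∀ L K b m → K < m → row L K b m ≡ 0ℚ
row-> L K b m K<m = sum-zero (suc L) (λ n → trans (cong (b n *_) (conn-> n K<m)) (*-zeroʳ (b n)))

pair-comm : ∀ L K a b → pair L K a b ≡ pair L K b a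
pair-comm L K a b = begin
  sum (suc L) (λ m → a m * sum (suc L) (λ n → b n * conn K m n))
    ≡⟨ sum-cong (suc L) (λ m → sum-*ˡ (suc L) (a m) _) ⟨
  sum (suc L) (λ m → sum (suc L) (λ n → a m * (b n * conn K m n)))
    ≡⟨ sum-swap (suc L) (suc L) _ ⟩
  sum (suc L) (λ n → sum (suc L) (λ m → a m * (b n * conn K m n)))
    ≡⟨ sum-cong (suc L) (λ n → trans (sum-cong (suc L) (λ m →
         trans (alg (a m) (b n) (conn K m n)) (cong (λ t → b n * (a m * t)) (conn-comm K m n))))
         (sum-*ˡ (suc L) (b n) _)) ⟩
  sum (suc L) (λ n → b n * sum (suc L) (λ m → a m * conn K n m)) ∎
  where
  open ≡-Reasoning
  alg : ∀ a b c → a * (b * c) ≡ b * (a * c)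
  alg = solve-∀ ℚ-ring

-- At K = 0 the connector leaves only m = 0, where `opX a` is 0. This is the initial value for every
-- induction on K.
pair-opX-0 : ∀ L a b → pair L 0 (opX a) b ≡ 0ℚ
pair-opX-0 L a b = sum-zero (suc L) go
  where
  go : ∀ m → opX a m * row L 0 b m ≡ 0ℚ
  go zero    = trans (cong (_* row L 0 b 0) (*-zeroˡ (a 0))) (*-zeroˡ (row L 0 b 0))
  go (suc m) = trans (cong (opX a (suc m) *_) (row-> L 0 b (suc m) (s≤s z≤n))) (*-zeroʳ (opX a (suc m)))

row-z₂ : ∀ L K b m → sq (suc m) * (row L (suc K) b (suc m) - row L K b (suc m)) ≡
  sq (suc K) * (row L K b m - row L K b (suc m))
row-z₂ L K b m = begin
  sq (suc m) * (row L (suc K) b (suc m) - row L K b (suc m))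
    ≡⟨ cong (sq (suc m) *_) (sum-- (suc L) _ _) ⟨
  sq (suc m) * sum (suc L) (λ n → b n * conn (suc K) (suc m) n - b n * conn K (suc m) n)
    ≡⟨ sum-*ˡ (suc L) (sq (suc m)) _ ⟨
  sum (suc L) (λ n → sq (suc m) * (b n * conn (suc K) (suc m) n - b n * conn K (suc m) n))
    ≡⟨ sum-cong (suc L) term ⟩
  sum (suc L) (λ n → sq (suc K) * (b n * conn K m n - b n * conn K (suc m) n))
    ≡⟨ sum-*ˡ (suc L) (sq (suc K)) _ ⟩
  sq (suc K) * sum (suc L) (λ n → b n * conn K m n - b n * conn K (suc m) n)
    ≡⟨ cong (sq (suc K) *_) (sum-- (suc L) _ _) ⟩
  sq (suc K) * (row L K b m - row L K b (suc m)) ∎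
  where
  open ≡-Reasoning
  factor : ∀ s b u v → s * (b * u - b * v) ≡ b * (s * (u - v))
  factor = solve-∀ ℚ-ring
  term : ∀ n → sq (suc m) * (b n * conn (suc K) (suc m) n - b n * conn K (suc m) n) ≡
    sq (suc K) * (b n * conn K m n - b n * conn K (suc m) n)
  term n = trans (factor (sq (suc m)) (b n) _ _) (trans (cong (b n *_) (conn-z₂ K m n))
    (sym (factor (sq (suc K)) (b n) (conn K m n) (conn K (suc m) n))))

-- `conn-z₂` replaces the weight (m + 1)⁻² by (K + 1)⁻² and the difference in K by one in m;
-- summation by parts then strips the partial sum in `opY`. As b only enters through its row, it
-- stays arbitrary.
pair-z₂ : ∀ L K a b → K < L →
  pair L (suc K) (opz₂ a) b - pair L K (opz₂ a) b ≡ sq (suc K) * pair L K a b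
pair-z₂ L K a b K<L = begin
  pair L (suc K) (opz₂ a) b - pair L K (opz₂ a) b
    ≡⟨ cong₂ _-_ (sum-drop L _ (*-zeroˡ (row L (suc K) b 0))) (sum-drop L _ (*-zeroˡ (row L K b 0))) ⟩
  sum L (λ m → opz₂ a (suc m) * row L (suc K) b (suc m)) - sum L (λ m → opz₂ a (suc m) * row L K b (suc m))
    ≡⟨ sum-linear L (sq (suc K)) _ _ _ term ⟩
  sq (suc K) * sum L (λ m → sum (suc m) a * (row L K b m - row L K b (suc m)))
    ≡⟨ cong (sq (suc K) *_) (abel-vanishing L a (row L K b) (row-> L K b L K<L)) ⟨
  sq (suc K) * pair L K a b ∎
  where
  open ≡-Reasoning
  alg : ∀ r A u v → r * (r * A) * u - r * (r * A) * v ≡ A * (r * r * (u - v))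
  alg = solve-∀ ℚ-ring
  alg₂ : ∀ A s u → A * (s * u) ≡ s * (A * u)
  alg₂ = solve-∀ ℚ-ring
  term : ∀ m → opz₂ a (suc m) * row L (suc K) b (suc m) - opz₂ a (suc m) * row L K b (suc m) ≡
    sq (suc K) * (sum (suc m) a * (row L K b m - row L K b (suc m)))
  term m = trans (alg (recip (suc m)) (sum (suc m) a) _ _)
    (trans (cong (sum (suc m) a *_) (row-z₂ L K b m)) (alg₂ (sum (suc m) a) (sq (suc K)) _))

cube : ℕ → ℚ
cube n = recip n * recip n * recip n

row-ε : ∀ L K m → row L K (coef ε) m ≡ conn K m 0
row-ε L K m = trans (sum-front L _) (trans (cong₂ _+_ (*-identityˡ (conn K m 0))
  (sum-zero L (λ n → *-zeroˡ (conn K m (suc n))))) (+-identityʳ (conn K m 0)))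

-- The argument of `pair-z₂` with a cube as weight, possible because against ε only the connector
-- with second index 0 occurs, to which `conn-jump-K` applies.
pair-z₃-ε : ∀ L K a → K < L →
  pair L (suc K) (opz₃ a) (coef ε) - pair L K (opz₃ a) (coef ε) ≡ cube (suc K) * pair L K a (coef ε)
pair-z₃-ε L K a K<L = begin
  pair L (suc K) (opz₃ a) (coef ε) - pair L K (opz₃ a) (coef ε)
    ≡⟨ cong₂ _-_ (sum-drop L _ (*-zeroˡ (row L (suc K) (coef ε) 0)))
        (sum-drop L _ (*-zeroˡ (row L K (coef ε) 0))) ⟩
  sum L (λ m → opz₃ a (suc m) * row L (suc K) (coef ε) (suc m)) - sum L
      (λ m → opz₃ a (suc m) * row L K (coef ε) (suc m))
    ≡⟨ sum-linear L (cube (suc K)) _ _ _ term ⟩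
  cube (suc K) * sum L (λ m → sum (suc m) a * (row L K (coef ε) m - row L K (coef ε) (suc m)))
    ≡⟨ cong (cube (suc K) *_) (abel-vanishing L a (row L K (coef ε)) (row-> L K (coef ε) L K<L)) ⟨
  cube (suc K) * pair L K a (coef ε) ∎
  where
  open ≡-Reasoning
  alg : ∀ r A u v → r * (r * (r * A)) * u - r * (r * (r * A)) * v ≡ A * (r * r * r * (u - v))
  alg = solve-∀ ℚ-ring
  alg₂ : ∀ A s u → A * (s * u) ≡ s * (A * u)
  alg₂ = solve-∀ ℚ-ring
  term : ∀ m → opz₃ a (suc m) * row L (suc K) (coef ε) (suc m) - opz₃ a (suc m) * row L K (coef ε) (suc m) ≡
    cube (suc K) * (sum (suc m) a * (row L K (coef ε) m - row L K (coef ε) (suc m)))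
  term m rewrite row-ε L (suc K) (suc m) | row-ε L K (suc m) | row-ε L K m =
    trans (alg (recip (suc m)) (sum (suc m) a) (conn (suc K) (suc m) 0) (conn K (suc m) 0))
    (trans (cong (sum (suc m) a *_) (conn-jump-K cube K m)) (alg₂ (sum (suc m) a) (cube (suc K)) _))

sum₂ : ℕ → (ℕ → ℕ → ℚ) → ℚ
sum₂ L f = sum L (λ m → sum L (f m))

pair-drop : ∀ L K a b → a 0 ≡ 0ℚ → b 0 ≡ 0ℚ →
  pair L K a b ≡ sum₂ L (λ m n → a (suc m) * (b (suc n) * conn K (suc m) (suc n)))
pair-drop L K a b a0 b0 = trans (sum-drop L _ (trans (cong (_* row L K b 0) a0) (*-zeroˡ (row L K b 0))))
  (sum-cong L (λ m → trans
    (cong (a (suc m) *_) (sum-drop L _ (trans (cong (_* conn K (suc m) 0) b0)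
        (*-zeroˡ (conn K (suc m) 0)))))
    (sym (sum-*ˡ L (a (suc m)) _))))

pair-abelˡ : ∀ L K a b → K < L → b 0 ≡ 0ℚ → pair L K a b ≡
  sum₂ L (λ m n → sum (suc m) a * (b (suc n) * (conn K m (suc n) - conn K (suc m) (suc n))))
pair-abelˡ L K a b K<L b0 = trans (abel-vanishing L a (row L K b) (row-> L K b L K<L))
  (sum-cong L (λ m → trans (cong (sum (suc m) a *_) (inner m)) (sym (sum-*ˡ L (sum (suc m) a) _))))
  where
  alg : ∀ b u v → b * u - b * v ≡ b * (u - v)
  alg = solve-∀ ℚ-ring
  inner : ∀ m → row L K b m - row L K b (suc m) ≡
    sum L (λ n → b (suc n) * (conn K m (suc n) - conn K (suc m) (suc n)))
  inner m = trans
    (cong₂ _-_ (sum-drop L _ (trans (cong (_* conn K m 0) b0) (*-zeroˡ (conn K m 0))))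
               (sum-drop L _ (trans (cong (_* conn K (suc m) 0) b0) (*-zeroˡ (conn K (suc m) 0)))))
    (trans (sym (sum-- L _ _)) (sum-cong L (λ n → alg (b (suc n)) (conn K m (suc n))
        (conn K (suc m) (suc n)))))

pair-abelʳ : ∀ L K a b → K < L → a 0 ≡ 0ℚ → pair L K a b ≡
  sum₂ L (λ m n → a (suc m) * (sum (suc n) b * (conn K (suc m) n - conn K (suc m) (suc n))))
pair-abelʳ L K a b K<L a0 = trans (sum-drop L _ (trans (cong (_* row L K b 0) a0) (*-zeroˡ (row L K b 0))))
  (sum-cong L (λ m → trans
    (cong (a (suc m) *_) (abel-vanishing L b (conn K (suc m))
        (trans (conn-comm K (suc m) L) (conn-> (suc m) K<L))))
    (sym (sum-*ˡ L (a (suc m)) _))))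

-- In the sum of `conn-z₃` over m and n, the first term contains a difference in m and is summed by
-- parts to strip z₃ from the left argument; the second does the same in n on the right. The third
-- contains no difference, so each partial sum stays and each argument keeps a z₂.
pair-z₃-z₃ : ∀ L K a b → K < L →
  pair L (suc K) (opz₃ a) (opz₃ b) - pair L K (opz₃ a) (opz₃ b) ≡
  cube (suc K) * (pair L K a (opz₃ b) + pair L K (opz₃ a) b) + sq (suc K) * pair L K (opz₂ a) (opz₂ b)
pair-z₃-z₃ L K a b K<L = begin
  pair L (suc K) (opz₃ a) (opz₃ b) - pair L K (opz₃ a) (opz₃ b)
    ≡⟨ cong₂ _-_ (pair-drop L (suc K) (opz₃ a) (opz₃ b) refl refl)
        (pair-drop L K (opz₃ a) (opz₃ b) refl refl) ⟩
  sum₂ L F₊ - sum₂ L F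
    ≡⟨ sum-- L _ _ ⟨
  sum L (λ m → sum L (F₊ m) - sum L (F m))
    ≡⟨ sum-cong L inner ⟩
  sum L (λ m → cube (suc K) * (sum L (G m) + sum L (H m)) + sq (suc K) * sum L (I m))
    ≡⟨ sum-+ L _ _ ⟩
  sum L (λ m → cube (suc K) * (sum L (G m) + sum L (H m))) + sum L (λ m → sq (suc K) * sum L (I m))
    ≡⟨ cong₂ _+_ (trans (sum-*ˡ L (cube (suc K)) _) (cong (cube (suc K) *_) (sum-+ L _ _)))
        (sum-*ˡ L (sq (suc K)) _) ⟩
  cube (suc K) * (sum₂ L G + sum₂ L H) + sq (suc K) * sum₂ L I
    ≡⟨ cong₂ (λ t u → cube (suc K) * t + sq (suc K) * u)
         (cong₂ _+_ (pair-abelˡ L K a (opz₃ b) K<L refl) (pair-abelʳ L K (opz₃ a) b K<L refl))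
         (pair-drop L K (opz₂ a) (opz₂ b) refl refl) ⟨
  cube (suc K) * (pair L K a (opz₃ b) + pair L K (opz₃ a) b) + sq (suc K) * pair L K (opz₂ a) (opz₂ b) ∎
  where
  open ≡-Reasoning
  F₊ F G H I : ℕ → ℕ → ℚ
  F₊ m n = opz₃ a (suc m) * (opz₃ b (suc n) * conn (suc K) (suc m) (suc n))
  F m n = opz₃ a (suc m) * (opz₃ b (suc n) * conn K (suc m) (suc n))
  G m n = sum (suc m) a * (opz₃ b (suc n) * (conn K m (suc n) - conn K (suc m) (suc n)))
  H m n = opz₃ a (suc m) * (sum (suc n) b * (conn K (suc m) n - conn K (suc m) (suc n)))
  I m n = opz₂ a (suc m) * (opz₂ b (suc n) * conn K (suc m) (suc n))
  factor : ∀ c d u v → c * (d * u) - c * (d * v) ≡ c * (d * (u - v))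
  factor = solve-∀ ℚ-ring
  term : ∀ m n → F₊ m n - F m n ≡ cube (suc K) * (G m n + H m n) + sq (suc K) * I m n
  term m n = trans (factor (opz₃ a (suc m)) (opz₃ b (suc n)) (conn (suc K) (suc m) (suc n))
      (conn K (suc m) (suc n)))
    (conn-z₃ K m n (sum (suc m) a) (sum (suc n) b))
  inner : ∀ m → sum L (F₊ m) - sum L (F m) ≡
    cube (suc K) * (sum L (G m) + sum L (H m)) + sq (suc K) * sum L (I m)
  inner m = trans (sym (sum-- L _ _)) (trans (sum-cong L (term m)) (trans (sum-+ L _ _)
    (cong₂ _+_ (trans (sum-*ˡ L (cube (suc K)) _) (cong (cube (suc K) *_) (sum-+ L _ _)))
        (sum-*ˡ L (sq (suc K)) _))))

-- Comparison with ⋆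

/1-homo-* : ∀ c d → (c ℤ.* d) / 1 ≡ c / 1 * (d / 1)
/1-homo-* c d = toℚᵘ-injective (begin
  toℚᵘ ((c ℤ.* d) / 1)             ≈⟨ toℚᵘ-fromℚᵘ (ℚᵘ.mkℚᵘ (c ℤ.* d) 0) ⟩
  ℚᵘ.mkℚᵘ c 0 ℚᵘ.* ℚᵘ.mkℚᵘ d 0     ≈⟨ ℚᵘₚ.*-cong (toℚᵘ-fromℚᵘ (ℚᵘ.mkℚᵘ c 0)) (toℚᵘ-fromℚᵘ (ℚᵘ.mkℚᵘ d 0)) ⟨
  toℚᵘ (c / 1) ℚᵘ.* toℚᵘ (d / 1)   ≈⟨ toℚᵘ-homo-* (c / 1) (d / 1) ⟨
  toℚᵘ (c / 1 * (d / 1))           ∎)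
  where open ℚᵘₚ.≃-Reasoning

module _ {B : Set} where

  evalℚ-⟨⟩ : ∀ (f : B → ℚ) b → evalℚ f ⟨ b ⟩ ≡ f b
  evalℚ-⟨⟩ f b = trans (+-identityʳ _) (*-identityˡ (f b))

  evalℚ-pointwise : ∀ {f g : B → ℚ} → (∀ b → f b ≡ g b) → ∀ p → evalℚ f p ≡ evalℚ g p
  evalℚ-pointwise eq []            = refl
  evalℚ-pointwise eq ((c , b) ∷ p) = cong₂ (λ s t → c / 1 * s + t) (eq b) (evalℚ-pointwise eq p)

  evalℚ-mapBasis : ∀ {C : Set} (f : C → ℚ) (φ : B → C) p → evalℚ f (mapBasis φ p) ≡ evalℚ (f ∘ φ) p
  evalℚ-mapBasis f φ []            = refl
  evalℚ-mapBasis f φ ((c , b) ∷ p) = cong (c / 1 * f (φ b) +_) (evalℚ-mapBasis f φ p)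

  evalℚ-++ : ∀ (f : B → ℚ) p q → evalℚ f (p ++ q) ≡ evalℚ f p + evalℚ f q
  evalℚ-++ f []            q = sym (+-identityˡ _)
  evalℚ-++ f ((c , b) ∷ p) q = trans (cong (c / 1 * f b +_) (evalℚ-++ f p q))
      (sym (+-assoc (c / 1 * f b) _ _))

  evalℚ-• : ∀ (f : B → ℚ) c p → evalℚ f (c • p) ≡ c / 1 * evalℚ f p
  evalℚ-• f c []            = sym (*-zeroʳ (c / 1))
  evalℚ-• f c ((d , b) ∷ p) = trans
    (cong₂ (λ s t → s * f b + t) (/1-homo-* c d) (evalℚ-• f c p)) (alg (c / 1) (d / 1) (f b) (evalℚ f p))
    where
    alg : ∀ c d u v → c * d * u + c * v ≡ c * (d * u + v)
    alg = solve-∀ ℚ-ring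

  evalℚ-Δ : ∀ c (f g h : B → ℚ) → (∀ b → f b - g b ≡ c * h b) →
    ∀ p → evalℚ f p - evalℚ g p ≡ c * evalℚ h p
  evalℚ-Δ c f g h eq []            = sym (*-zeroʳ c)
  evalℚ-Δ c f g h eq ((d , b) ∷ p) = trans (left (d / 1) (f b) (g b) _ _)
    (trans (cong₂ (λ s t → d / 1 * s + t) (eq b) (evalℚ-Δ c f g h eq p)) (right c (d / 1) (h b) _))
    where
    left : ∀ d u v s t → (d * u + s) - (d * v + t) ≡ d * (u - v) + (s - t)
    left = solve-∀ ℚ-ring
    right : ∀ c d u s → d * (c * u) + c * s ≡ c * (d * u + s)
    right = solve-∀ ℚ-ring

  evalℚ-zero : ∀ {f : B → ℚ} → (∀ b → f b ≡ 0ℚ) → ∀ p → evalℚ f p ≡ 0ℚ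
  evalℚ-zero eq []            = refl
  evalℚ-zero eq ((c , b) ∷ p) =
    trans (cong₂ (λ s t → c / 1 * s + t) (eq b) (evalℚ-zero eq p)) (trans (+-identityʳ _) (*-zeroʳ (c / 1)))

evalℚ-bilinear : ∀ {B C D : Set} (f : D → ℚ) (h : B → C → Lin D) p q →
  evalℚ f (bilinear h p q) ≡ evalℚ (λ b → evalℚ (λ c → evalℚ f (h b c)) q) p
evalℚ-bilinear f h []            q = refl
evalℚ-bilinear f h ((c , b) ∷ p) q = trans
  (evalℚ-++ f (concatMap (λ (d , b′) → (c ℤ.* d) • h b b′) q) _) (cong₂ _+_ (go q) (evalℚ-bilinear f h p q))
  where
  alg : ∀ c d u v → c * d * u + c * v ≡ c * (d * u + v)
  alg = solve-∀ ℚ-ring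
  go : ∀ q → evalℚ f (concatMap (λ (d , b′) → (c ℤ.* d) • h b b′) q) ≡
    c / 1 * evalℚ (λ b′ → evalℚ f (h b b′)) q
  go []             = sym (*-zeroʳ (c / 1))
  go ((d , b′) ∷ q) = begin
    evalℚ f ((c ℤ.* d) • h b b′ ++ concatMap (λ (d , b′) → (c ℤ.* d) • h b b′) q)
      ≡⟨ evalℚ-++ f ((c ℤ.* d) • h b b′) _ ⟩
    evalℚ f ((c ℤ.* d) • h b b′) + evalℚ f (concatMap (λ (d , b′) → (c ℤ.* d) • h b b′) q)
      ≡⟨ cong₂ _+_ (trans (evalℚ-• f (c ℤ.* d) (h b b′)) (cong (_* evalℚ f (h b b′)) (/1-homo-* c d)))
          (go q) ⟩
    c / 1 * (d / 1) * evalℚ f (h b b′) + c / 1 * evalℚ (λ b′ → evalℚ f (h b b′)) q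
      ≡⟨ alg (c / 1) (d / 1) (evalℚ f (h b b′)) _ ⟩
    c / 1 * (d / 1 * evalℚ f (h b b′) + evalℚ (λ b′ → evalℚ f (h b b′)) q) ∎
    where open ≡-Reasoning

value : ℕ → ℕ → Word²³ → ℚ
value L K w = pair L K (coef w) (coef ε)

equal-increments : ∀ {L} (f g : ℕ → ℚ) → f 0 ≡ g 0 →
  (∀ K → K < L → f (suc K) - f K ≡ g (suc K) - g K) → ∀ K → K ≤ L → f K ≡ g K
equal-increments f g eq₀ Δ zero    _   = eq₀
equal-increments f g eq₀ Δ (suc K) K<L = trans (recover (f (suc K)) (f K))
  (trans (cong₂ _+_ (Δ K K<L) (equal-increments f g eq₀ Δ K (ℕₚ.<⇒≤ K<L)))
      (sym (recover (g (suc K)) (g K))))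
  where
  recover : ∀ a b → a ≡ (a - b) + b
  recover = solve-∀ ℚ-ring

evalℚ-Δ-mapBasis : ∀ L K c (φ : Word²³ → Word²³) →
  (∀ w → value L (suc K) (φ w) - value L K (φ w) ≡ c * value L K w) → ∀ p →
  evalℚ (value L (suc K)) (mapBasis φ p) - evalℚ (value L K) (mapBasis φ p) ≡ c * evalℚ (value L K) p
evalℚ-Δ-mapBasis L K c φ eq p = trans
  (cong₂ _-_ (evalℚ-mapBasis (value L (suc K)) φ p) (evalℚ-mapBasis (value L K) φ p))
  (evalℚ-Δ c _ _ _ eq p)

evalℚ-mapBasis-0 : ∀ L (φ : Word²³ → Word²³) → (∀ w → value L 0 (φ w) ≡ 0ℚ) → ∀ p →
  evalℚ (value L 0) (mapBasis φ p) ≡ 0ℚ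
evalℚ-mapBasis-0 L φ eq p = trans (evalℚ-mapBasis (value L 0) φ p) (evalℚ-zero eq p)

-- Stated for arbitrary a, b and p, so that with `pair-comm` it removes a z₂ from either argument
-- and can be applied twice in a row.
value-z₂-step : ∀ L a b p →
  (∀ K → K ≤ L → pair L K a b ≡ evalℚ (value L K) p) →
  ∀ K → K ≤ L → pair L K (opz₂ a) b ≡ evalℚ (value L K) (mapBasis _z₂ p)
value-z₂-step L a b p eq = equal-increments _ _
  (trans (pair-opX-0 L (opY a) b) (sym (evalℚ-mapBasis-0 L _z₂
      (λ w → pair-opX-0 L (opY (coef w)) (coef ε)) p)))
  (λ K K<L → trans (pair-z₂ L K a b K<L) (trans (cong (sq (suc K) *_) (eq K (ℕₚ.<⇒≤ K<L)))
    (sym (evalℚ-Δ-mapBasis L K (sq (suc K)) _z₂ (λ w → pair-z₂ L K (coef w) (coef ε) K<L) p))))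

-- Recursion on the two words, with an inner induction on K that compares increments. The bound L
-- stays fixed throughout, and the claim is needed for all K ≤ L because an increment at K refers to
-- shorter words at the same K.
value-⋆ : ∀ L v w K → K ≤ L → pair L K (coef v) (coef w) ≡ evalℚ (value L K) (v ⋆ʷ w)
value-⋆ L ε      w      K K≤L = trans (pair-comm L K (coef ε) (coef w)) (sym (evalℚ-⟨⟩ (value L K) w))
value-⋆ L (v z₂) w      = value-z₂-step L (coef v) (coef w) (v ⋆ʷ w) (value-⋆ L v w)
value-⋆ L (v z₃) ε      K K≤L = sym (evalℚ-⟨⟩ (value L K) (v z₃))
value-⋆ L (v z₃) (w z₂) K K≤L = trans (pair-comm L K (coef (v z₃)) (coef (w z₂)))
  (value-z₂-step L (coef w) (coef (v z₃)) (v z₃ ⋆ʷ w)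
    (λ K′ K′≤L → trans (pair-comm L K′ (coef w) (coef (v z₃))) (value-⋆ L (v z₃) w K′ K′≤L)) K K≤L)
value-⋆ L (v z₃) (w z₃) = equal-increments _ _ start step
  where
  z₂³ : Word²³ → Word²³
  z₂³ u = u z₂ z₂ z₂
  p q r : ℋ²³
  p = v ⋆ʷ w z₃
  q = v z₃ ⋆ʷ w
  r = v ⋆ʷ w
  expand : ∀ K → evalℚ (value L K) (mapBasis _z₃ p ++ mapBasis _z₃ q ++ mapBasis z₂³ r) ≡
    evalℚ (value L K) (mapBasis _z₃ p) + (evalℚ (value L K) (mapBasis _z₃ q) + evalℚ (value L K)
        (mapBasis z₂³ r))
  expand K = trans (evalℚ-++ (value L K) (mapBasis _z₃ p) _)
    (cong (evalℚ (value L K) (mapBasis _z₃ p) +_) (evalℚ-++ (value L K) (mapBasis _z₃ q) _))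
  start : pair L 0 (coef (v z₃)) (coef (w z₃)) ≡
    evalℚ (value L 0) (mapBasis _z₃ p ++ mapBasis _z₃ q ++ mapBasis z₂³ r)
  start = trans (pair-opX-0 L (opX (opY (coef v))) (coef (w z₃))) (sym (trans (expand 0)
    (cong₂ _+_ (evalℚ-mapBasis-0 L _z₃ z₃-0 p) (cong₂ _+_ (evalℚ-mapBasis-0 L _z₃ z₃-0 q)
      (evalℚ-mapBasis-0 L z₂³ (λ u → pair-opX-0 L (opY (coef (u z₂ z₂))) (coef ε)) r)))))
    where
    z₃-0 : ∀ u → value L 0 (u z₃) ≡ 0ℚ
    z₃-0 u = pair-opX-0 L (opX (opY (coef u))) (coef ε)
  -- A call of `value-⋆` at `v z₂` and `w z₂` would not be structurally decreasing, so both z₂ are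
  -- peeled off here and the recursion is made at v and w.
  z₂-z₂ : ∀ K → K ≤ L → pair L K (coef (v z₂)) (coef (w z₂)) ≡ evalℚ (value L K)
      (mapBasis (λ u → u z₂ z₂) r)
  z₂-z₂ K K≤L = trans
    (value-z₂-step L (coef v) (coef (w z₂)) (mapBasis _z₂ r) (λ K′ K′≤L →
      trans (pair-comm L K′ (coef v) (coef (w z₂)))
        (value-z₂-step L (coef w) (coef v) r (λ K″ K″≤L →
          trans (pair-comm L K″ (coef w) (coef v)) (value-⋆ L v w K″ K″≤L)) K′ K′≤L)) K K≤L)
    (trans (evalℚ-mapBasis (value L K) _z₂ (mapBasis _z₂ r))
      (trans (evalℚ-mapBasis (value L K ∘ _z₂) _z₂ r) (sym (evalℚ-mapBasis (value L K) (λ u → u z₂ z₂) r))))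
  step : ∀ K → K < L →
    pair L (suc K) (coef (v z₃)) (coef (w z₃)) - pair L K (coef (v z₃)) (coef (w z₃)) ≡
    evalℚ (value L (suc K)) (mapBasis _z₃ p ++ mapBasis _z₃ q ++ mapBasis z₂³ r)
      - evalℚ (value L K) (mapBasis _z₃ p ++ mapBasis _z₃ q ++ mapBasis z₂³ r)
  step K K<L = begin
    pair L (suc K) (coef (v z₃)) (coef (w z₃)) - pair L K (coef (v z₃)) (coef (w z₃))
      ≡⟨ pair-z₃-z₃ L K (coef v) (coef w) K<L ⟩
    cube (suc K) * (pair L K (coef v) (coef (w z₃)) + pair L K (coef (v z₃)) (coef w))
      + sq (suc K) * pair L K (coef (v z₂)) (coef (w z₂))
      ≡⟨ cong₂ (λ s t → cube (suc K) * s + sq (suc K) * t)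
           (cong₂ _+_ (value-⋆ L v (w z₃) K (ℕₚ.<⇒≤ K<L)) (value-⋆ L (v z₃) w K (ℕₚ.<⇒≤ K<L)))
           (trans (z₂-z₂ K (ℕₚ.<⇒≤ K<L)) (evalℚ-mapBasis (value L K) (λ u → u z₂ z₂) r)) ⟩
    cube (suc K) * (V K p + V K q) + sq (suc K) * evalℚ (λ u → value L K (u z₂ z₂)) r
      ≡⟨ distr (cube (suc K)) (V K p) (V K q) _ ⟩
    cube (suc K) * V K p + (cube (suc K) * V K q + sq (suc K) * evalℚ (λ u → value L K (u z₂ z₂)) r)
      ≡⟨ cong₂ _+_ (z₃-Δ p) (cong₂ _+_ (z₃-Δ q) z₂³-Δ) ⟨
    (V (suc K) (mapBasis _z₃ p) - V K (mapBasis _z₃ p)) +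
      ((V (suc K) (mapBasis _z₃ q) - V K (mapBasis _z₃ q)) +
          (V (suc K) (mapBasis z₂³ r) - V K (mapBasis z₂³ r)))
      ≡⟨ medial (V (suc K) (mapBasis _z₃ p)) _ (V (suc K) (mapBasis _z₃ q)) _
          (V (suc K) (mapBasis z₂³ r)) _ ⟩
    (V (suc K) (mapBasis _z₃ p) + (V (suc K) (mapBasis _z₃ q) + V (suc K) (mapBasis z₂³ r)))
      - (V K (mapBasis _z₃ p) + (V K (mapBasis _z₃ q) + V K (mapBasis z₂³ r)))
      ≡⟨ cong₂ _-_ (expand (suc K)) (expand K) ⟨
    V (suc K) (mapBasis _z₃ p ++ mapBasis _z₃ q ++ mapBasis z₂³ r)
      - V K (mapBasis _z₃ p ++ mapBasis _z₃ q ++ mapBasis z₂³ r) ∎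
    where
    open ≡-Reasoning
    V : ℕ → ℋ²³ → ℚ
    V K = evalℚ (value L K)
    z₃-Δ : ∀ p → V (suc K) (mapBasis _z₃ p) - V K (mapBasis _z₃ p) ≡ cube (suc K) * V K p
    z₃-Δ = evalℚ-Δ-mapBasis L K (cube (suc K)) _z₃ (λ u → pair-z₃-ε L K (coef u) K<L)
    -- Two of the three z₂ come from T_K(v z₂, w z₂); the third accounts for its factor (K + 1)⁻².
    z₂³-Δ : V (suc K) (mapBasis z₂³ r) - V K (mapBasis z₂³ r) ≡ sq (suc K) * evalℚ
        (λ u → value L K (u z₂ z₂)) r
    z₂³-Δ = trans (cong₂ _-_ (evalℚ-mapBasis (value L (suc K)) z₂³ r) (evalℚ-mapBasis (value L K) z₂³ r))
      (evalℚ-Δ (sq (suc K)) _ _ _ (λ u → pair-z₂ L K (coef (u z₂ z₂)) (coef ε) K<L) r)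
    distr : ∀ c s t u → c * (s + t) + u ≡ c * s + (c * t + u)
    distr = solve-∀ ℚ-ring
    medial : ∀ a a′ b b′ c c′ → (a - a′) + ((b - b′) + (c - c′)) ≡ (a + (b + c)) - (a′ + (b′ + c′))
    medial = solve-∀ ℚ-ring

-- Expansions in ratios of binomial coefficients

-- For a = coef w, inc K a j is the sum over all indices of w with last index j (at level
-- N = K + 1), and cum K a M is the sum over those with last index at most M.
cum inc : ℕ → (ℕ → ℚ) → ℕ → ℚ
cum K a M = sum (suc K) (λ n → a n * (bin M n * bin⁻¹ K n))
inc K a zero    = cum K a 0
inc K a (suc j) = cum K a (suc j) - cum K a j

sum-inc : ∀ K a M → sum (suc M) (inc K a) ≡ cum K a M
sum-inc K a zero    = +-identityˡ _
sum-inc K a (suc M) = trans (cong (_+ inc K a (suc M)) (sum-inc K a M)) (alg (cum K a M) (cum K a (suc M)))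
  where
  alg : ∀ s t → s + (t - s) ≡ t
  alg = solve-∀ ℚ-ring

-- The discrete form of tⁿ dt/t = d(tⁿ/n): for n ≥ 1, bin b n / b = (bin b n - bin (b - 1) n) / n.
-- The term n = 0 has no such form, whence the condition on a.
recip-cum : ∀ K a → a 0 ≡ 0ℚ → ∀ b → recip b * cum K a b ≡ inc K (opX a) b
recip-cum K a a0 zero    = trans (*-zeroˡ (cum K a 0)) (sym (sum-zero (suc K) go))
  where
  go : ∀ n → opX a n * (bin 0 n * bin⁻¹ K n) ≡ 0ℚ
  go zero    = trans (cong (_* (1ℚ * 1ℚ)) (*-zeroˡ (a 0))) (*-zeroˡ (1ℚ * 1ℚ))
  go (suc n) = trans (cong (opX a (suc n) *_) (*-zeroˡ (bin⁻¹ K (suc n)))) (*-zeroʳ (opX a (suc n)))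
recip-cum K a a0 (suc b) = trans (sym (sum-*ˡ (suc K) (recip (suc b)) _))
  (trans (sum-cong (suc K) go) (sum-- (suc K) _ _))
  where
  open ≡-Reasoning
  alg₀ : ∀ r u → r * (0ℚ * u) ≡ 0ℚ * 0ℚ * u - 0ℚ * 0ℚ * u
  alg₀ = solve-∀ ℚ-ring
  alg : ∀ k s r v a c → s * (a * (k * r * v * c)) ≡ k * s * (r * a * (v * c))
  alg = solve-∀ ℚ-ring
  alg₂ : ∀ r a v w c → r * a * (v * c) ≡ r * a * ((v + w) * c) - r * a * (w * c)
  alg₂ = solve-∀ ℚ-ring
  go : ∀ n → recip (suc b) * (a n * (bin (suc b) n * bin⁻¹ K n)) ≡
    opX a n * (bin (suc b) n * bin⁻¹ K n) - opX a n * (bin b n * bin⁻¹ K n)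
  go zero    rewrite a0 = alg₀ (recip (suc b)) (1ℚ * 1ℚ)
  go (suc n) = begin
    recip (suc b) * (a (suc n) * (bin (suc b) (suc n) * bin⁻¹ K (suc n)))
      ≡⟨ cong (λ t → recip (suc b) * (a (suc n) * (t * bin⁻¹ K (suc n)))) (bin-suc-suc b n) ⟩
    recip (suc b) * (a (suc n) * (⟦ suc b ⟧ * recip (suc n) * bin b n * bin⁻¹ K (suc n)))
      ≡⟨ alg ⟦ suc b ⟧ (recip (suc b)) (recip (suc n)) (bin b n) (a (suc n)) (bin⁻¹ K (suc n)) ⟩
    ⟦ suc b ⟧ * recip (suc b) * (opX a (suc n) * (bin b n * bin⁻¹ K (suc n)))
      ≡⟨ 1*-elim (⟦⟧*recip b) _ ⟩
    opX a (suc n) * (bin b n * bin⁻¹ K (suc n))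
      ≡⟨ alg₂ (recip (suc n)) (a (suc n)) (bin b n) (bin b (suc n)) (bin⁻¹ K (suc n)) ⟩
    opX a (suc n) * (bin (suc b) (suc n) * bin⁻¹ K (suc n)) - opX a (suc n) *
        (bin b (suc n) * bin⁻¹ K (suc n)) ∎

-- With ρ for the ratio, a difference of ρ in M becomes one in n, as in d(tⁿ⁺¹)/(n + 1) = (tⁿ -
-- tⁿ⁺¹) dt/(1 - t). Both sides equal bin M n / (K bin (K - 1) n), read as 0 for n ≥ K.
bin-ratio-Δ : ∀ {K M} n → M < K →
  recip (suc n) * (bin (suc M) (suc n) * bin⁻¹ K (suc n) - bin M (suc n) * bin⁻¹ K (suc n)) ≡
  recip (K ∸ M) * (bin M n * bin⁻¹ K n - bin M (suc n) * bin⁻¹ K (suc n))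
bin-ratio-Δ {suc K} {M} n (s≤s M≤K) = begin
  r * ((v + w) * (s * rK * c) - w * (s * rK * c))      ≡⟨ alg r v w s rK c ⟩
  s * r * (v * (rK * c))                               ≡⟨ 1*-elim (⟦⟧*recip n) _ ⟩
  v * (rK * c)                                         ≡⟨ 1*-elim gap _ ⟨
  (⟦ suc K ⟧ - ⟦ M ⟧) * d * (v * (rK * c))             ≡⟨ alg₂ ⟦ suc K ⟧ ⟦ M ⟧ ⟦ n ⟧ d v rK c ⟩
  d * (rK * (v * ((⟦ suc K ⟧ - ⟦ n ⟧) * c)) - (⟦ M ⟧ - ⟦ n ⟧) * v * (rK * c))
    ≡⟨ cong₂ (λ t u → d * (rK * t - u * (rK * c))) (sym lower) (sym (bin-step M n)) ⟩
  d * (rK * (v * (⟦ suc K ⟧ * bin⁻¹ (suc K) n)) - s * w * (rK * c))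
    ≡⟨ cong (d *_) (cong₂ _-_ (trans (alg₃ rK v ⟦ suc K ⟧ (bin⁻¹ (suc K) n)) (1*-elim (⟦⟧*recip K) _))
        (alg₄ s w rK c)) ⟩
  d * (v * bin⁻¹ (suc K) n - w * (s * rK * c)) ∎
  where
  open ≡-Reasoning
  r = recip (suc n)
  s = ⟦ suc n ⟧
  rK = recip (suc K)
  c = bin⁻¹ K n
  d = recip (suc K ∸ M)
  v = bin M n
  w = bin M (suc n)
  gap : (⟦ suc K ⟧ - ⟦ M ⟧) * d ≡ 1ℚ
  gap = trans (cong (_* d) (sym (⟦⟧-∸ (ℕₚ.m≤n⇒m≤1+n M≤K))))
    (trans (cong (λ t → ⟦ t ⟧ * recip t) (ℕₚ.+-∸-assoc 1 M≤K)) (⟦⟧*recip (K ∸ M)))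
  lower : v * (⟦ suc K ⟧ * bin⁻¹ (suc K) n) ≡ v * ((⟦ suc K ⟧ - ⟦ n ⟧) * c)
  lower with ℕₚ.≤-<-connex n K
  ... | inj₁ n≤K = cong (v *_) (bin⁻¹-suc n≤K)
  ... | inj₂ K<n = trans (cong (_* (⟦ suc K ⟧ * bin⁻¹ (suc K) n)) v≡0)
    (trans (*-zeroˡ (⟦ suc K ⟧ * bin⁻¹ (suc K) n))
      (sym (trans (cong (_* ((⟦ suc K ⟧ - ⟦ n ⟧) * c)) v≡0) (*-zeroˡ ((⟦ suc K ⟧ - ⟦ n ⟧) * c)))))
    where
    v≡0 : v ≡ 0ℚ
    v≡0 = bin-> (ℕₚ.≤-<-trans M≤K K<n)
  alg : ∀ r v w s k c → r * ((v + w) * (s * k * c) - w * (s * k * c)) ≡ s * r * (v * (k * c))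
  alg = solve-∀ ℚ-ring
  alg₂ : ∀ K M n d v k c → (K - M) * d * (v * (k * c)) ≡ d *
      (k * (v * ((K - n) * c)) - (M - n) * v * (k * c))
  alg₂ = solve-∀ ℚ-ring
  alg₃ : ∀ k v K c → k * (v * (K * c)) ≡ K * k * (v * c)
  alg₃ = solve-∀ ℚ-ring
  alg₄ : ∀ s w k c → s * w * (k * c) ≡ w * (s * k * c)
  alg₄ = solve-∀ ℚ-ring

-- The discrete form of integrating a power series against dt/(1 - t). Summation by parts in n
-- produces the partial sums of a, and `bin-ratio-Δ` turns the resulting differences in n into
-- differences in M, which telescope.
sum-recip-cum : ∀ K a M → M ≤ K → sum M (λ i → recip (K ∸ i) * cum K a i) ≡ cum K (opY a) M
sum-recip-cum K a zero    _   = sym (sum-zero (suc K) go)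
  where
  go : ∀ n → opY a n * (bin 0 n * bin⁻¹ K n) ≡ 0ℚ
  go zero    = refl
  go (suc n) = trans (cong (opY a (suc n) *_) (*-zeroˡ (bin⁻¹ K (suc n)))) (*-zeroʳ (opY a (suc n)))
sum-recip-cum K a (suc M) M<K = begin
  sum M (λ i → recip (K ∸ i) * cum K a i) + recip (K ∸ M) * cum K a M
    ≡⟨ cong₂ _+_ (sum-recip-cum K a M (ℕₚ.<⇒≤ M<K)) last-term ⟩
  cum K (opY a) M + (cum K (opY a) (suc M) - cum K (opY a) M)
    ≡⟨ alg (cum K (opY a) M) (cum K (opY a) (suc M)) ⟩
  cum K (opY a) (suc M) ∎
  where
  open ≡-Reasoning
  ratio : ℕ → ℕ → ℚ
  ratio M n = bin M n * bin⁻¹ K n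
  alg : ∀ s t → s + (t - s) ≡ t
  alg = solve-∀ ℚ-ring
  alg₂ : ∀ d A u → d * (A * u) ≡ A * (d * u)
  alg₂ = solve-∀ ℚ-ring
  alg₃ : ∀ r A u v → A * (r * (u - v)) ≡ r * A * u - r * A * v
  alg₃ = solve-∀ ℚ-ring
  last-term : recip (K ∸ M) * cum K a M ≡ cum K (opY a) (suc M) - cum K (opY a) M
  last-term = begin
    recip (K ∸ M) * cum K a M
      ≡⟨ cong (recip (K ∸ M) *_) (abel-vanishing K a (ratio M)
           (trans (cong (_* bin⁻¹ K K) (bin-> M<K)) (*-zeroˡ (bin⁻¹ K K)))) ⟩
    recip (K ∸ M) * sum K (λ n → sum (suc n) a * (ratio M n - ratio M (suc n)))
      ≡⟨ sum-*ˡ K (recip (K ∸ M)) _ ⟨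
    sum K (λ n → recip (K ∸ M) * (sum (suc n) a * (ratio M n - ratio M (suc n))))
      ≡⟨ sum-cong K (λ n → trans (alg₂ (recip (K ∸ M)) (sum (suc n) a) _)
           (trans (cong (sum (suc n) a *_) (sym (bin-ratio-Δ n M<K)))
             (alg₃ (recip (suc n)) (sum (suc n) a) (ratio (suc M) (suc n)) (ratio M (suc n))))) ⟩
    sum K (λ n → opY a (suc n) * ratio (suc M) (suc n) - opY a (suc n) * ratio M (suc n))
      ≡⟨ sum-- K _ _ ⟩
    sum K (λ n → opY a (suc n) * ratio (suc M) (suc n)) - sum K (λ n → opY a (suc n) * ratio M (suc n))
      ≡⟨ cong₂ _-_ (sum-drop K _ refl) (sum-drop K _ refl) ⟨
    cum K (opY a) (suc M) - cum K (opY a) M ∎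

-- Counts the (m + n + 1)-subsets of a K-set by the position j of their (m + 1)-st element. The
-- proof is Pascal's rule in the first factor.
vandermonde : ∀ K m n → sum K (λ j → bin j m * bin (K ∸ suc j) n) ≡ bin K (suc (m ℕ.+ n))
vandermonde zero    m n = refl
vandermonde (suc K) m n = trans (sum-front K _) (go m)
  where
  go : ∀ m → bin 0 m * bin K n + sum K (λ j → bin (suc j) m * bin (K ∸ suc j) n) ≡ bin (suc K)
      (suc (m ℕ.+ n))
  go zero    = cong₂ _+_ (*-identityˡ (bin K n)) (vandermonde K 0 n)
  go (suc m) = begin
    0ℚ * bin K n + sum K (λ j → (bin j m + bin j (suc m)) * bin (K ∸ suc j) n)
      ≡⟨ trans (cong (_+ sum K (λ j → (bin j m + bin j (suc m)) * bin (K ∸ suc j) n))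
          (*-zeroˡ (bin K n))) (+-identityˡ _) ⟩
    sum K (λ j → (bin j m + bin j (suc m)) * bin (K ∸ suc j) n)
      ≡⟨ sum-cong K (λ j → *-distribʳ-+ (bin (K ∸ suc j) n) (bin j m) (bin j (suc m))) ⟩
    sum K (λ j → bin j m * bin (K ∸ suc j) n + bin j (suc m) * bin (K ∸ suc j) n)
      ≡⟨ sum-+ K _ _ ⟩
    sum K (λ j → bin j m * bin (K ∸ suc j) n) + sum K (λ j → bin j (suc m) * bin (K ∸ suc j) n)
      ≡⟨ cong₂ _+_ (vandermonde K m n) (vandermonde K (suc m) n) ⟩
    bin K (suc (m ℕ.+ n)) + bin K (suc (suc m ℕ.+ n)) ∎
    where open ≡-Reasoning

binΔ : ℕ → ℕ → ℚ
binΔ zero    m = bin 0 m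
binΔ (suc j) m = bin (suc j) m - bin j m

-- For m ≥ 1 the difference at j ≥ 1 is bin (j - 1) (m - 1), which leads to `vandermonde`; for m = 0
-- only j = 0 contributes.
sum-binΔ : ∀ K m n → sum (suc K) (λ j → binΔ j m * bin (K ∸ j) n) ≡ bin K (m ℕ.+ n)
sum-binΔ K m n = trans (sum-front K _) (go m)
  where
  alg : ∀ u v b → ((u + v) - v) * b ≡ u * b
  alg = solve-∀ ℚ-ring
  go : ∀ m → bin 0 m * bin K n + sum K (λ j → binΔ (suc j) m * bin (K ∸ suc j) n) ≡ bin K (m ℕ.+ n)
  go zero    = trans (cong₂ _+_ (*-identityˡ (bin K n))
      (sum-zero K (λ j → *-zeroˡ (bin (K ∸ suc j) n)))) (+-identityʳ _)
  go (suc m) = trans (cong₂ _+_ (*-zeroˡ (bin K n))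
      (sum-cong K (λ j → alg (bin j m) (bin j (suc m)) (bin (K ∸ suc j) n))))
    (trans (+-identityˡ _) (vandermonde K m n))

inc-expand : ∀ K a j → inc K a j ≡ sum (suc K) (λ m → a m * (binΔ j m * bin⁻¹ K m))
inc-expand K a zero    = refl
inc-expand K a (suc j) = trans (sym (sum-- (suc K) _ _))
  (sum-cong (suc K) (λ m → alg (a m) (bin (suc j) m) (bin j m) (bin⁻¹ K m)))
  where
  alg : ∀ a u v c → a * (u * c) - a * (v * c) ≡ a * ((u - v) * c)
  alg = solve-∀ ℚ-ring

-- The origin of the connector: j is the last index of w₁, and the indices of τ(w₂), all above j,
-- have at most K - j positions after reflection. Summing over j merges the two numerators into bin
-- K (m + n), while the two denominators remain.
sum-inc-cum : ∀ K a b → sum (suc K) (λ j → inc K a j * cum K b (K ∸ j)) ≡ pair K K a b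
sum-inc-cum K a b = begin
  sum (suc K) (λ j → inc K a j * cum K b (K ∸ j))
    ≡⟨ sum-cong (suc K) (λ j → trans (cong (_* cum K b (K ∸ j)) (inc-expand K a j))
        (sym (sum-*ʳ (suc K) (cum K b (K ∸ j)) _))) ⟩
  sum (suc K) (λ j → sum (suc K) (λ m → a m * (binΔ j m * bin⁻¹ K m) * cum K b (K ∸ j)))
    ≡⟨ sum-swap (suc K) (suc K) _ ⟩
  sum (suc K) (λ m → sum (suc K) (λ j → a m * (binΔ j m * bin⁻¹ K m) * cum K b (K ∸ j)))
    ≡⟨ sum-cong (suc K) inner ⟩
  sum (suc K) (λ m → a m * sum (suc K) (λ n → b n * conn K m n)) ∎
  where
  open ≡-Reasoning
  alg : ∀ a d c s → a * (d * c) * s ≡ a * c * (d * s)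
  alg = solve-∀ ℚ-ring
  alg₂ : ∀ d b u c → d * (b * (u * c)) ≡ b * c * (d * u)
  alg₂ = solve-∀ ℚ-ring
  alg₃ : ∀ c b c′ u → c * (b * c′ * u) ≡ b * (u * c * c′)
  alg₃ = solve-∀ ℚ-ring
  inner : ∀ m → sum (suc K) (λ j → a m * (binΔ j m * bin⁻¹ K m) * cum K b (K ∸ j)) ≡
    a m * sum (suc K) (λ n → b n * conn K m n)
  inner m = begin
    sum (suc K) (λ j → a m * (binΔ j m * bin⁻¹ K m) * cum K b (K ∸ j))
      ≡⟨ sum-cong (suc K) (λ j → trans (alg (a m) (binΔ j m) (bin⁻¹ K m) (cum K b (K ∸ j)))
           (cong (a m * bin⁻¹ K m *_) (trans (sym (sum-*ˡ (suc K) (binΔ j m) _))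
             (sum-cong (suc K) (λ n → alg₂ (binΔ j m) (b n) (bin (K ∸ j) n) (bin⁻¹ K n)))))) ⟩
    sum (suc K) (λ j → a m * bin⁻¹ K m * sum (suc K) (λ n → b n * bin⁻¹ K n * (binΔ j m * bin (K ∸ j) n)))
      ≡⟨ sum-*ˡ (suc K) (a m * bin⁻¹ K m) _ ⟩
    a m * bin⁻¹ K m * sum (suc K) (λ j → sum (suc K) (λ n → b n * bin⁻¹ K n * (binΔ j m * bin (K ∸ j) n)))
      ≡⟨ cong (a m * bin⁻¹ K m *_) (sum-swap (suc K) (suc K) _) ⟩
    a m * bin⁻¹ K m * sum (suc K) (λ n → sum (suc K) (λ j → b n * bin⁻¹ K n * (binΔ j m * bin (K ∸ j) n)))
      ≡⟨ cong (a m * bin⁻¹ K m *_) (sum-cong (suc K) (λ n → trans (sum-*ˡ (suc K) (b n * bin⁻¹ K n) _)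
           (cong (b n * bin⁻¹ K n *_) (sum-binΔ K m n)))) ⟩
    a m * bin⁻¹ K m * sum (suc K) (λ n → b n * bin⁻¹ K n * bin K (m ℕ.+ n))
      ≡⟨ *-assoc (a m) (bin⁻¹ K m) _ ⟩
    a m * (bin⁻¹ K m * sum (suc K) (λ n → b n * bin⁻¹ K n * bin K (m ℕ.+ n)))
      ≡⟨ cong (a m *_) (trans (sym (sum-*ˡ (suc K) (bin⁻¹ K m) _))
           (sum-cong (suc K) (λ n → alg₃ (bin⁻¹ K m) (b n) (bin⁻¹ K n) (bin K (m ℕ.+ n))))) ⟩
    a m * sum (suc K) (λ n → b n * conn K m n) ∎

-- Iterated sums

ind : Bool → ℚ
ind b = if b then 1ℚ else 0ℚ

<ᵇ-true : ∀ {m n} → m < n → (m <ᵇ n) ≡ true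
<ᵇ-true {zero}  (s≤s _)         = refl
<ᵇ-true {suc m} (s≤s m<n@(s≤s _)) = <ᵇ-true m<n

<ᵇ-false : ∀ {m n} → n ≤ m → (m <ᵇ n) ≡ false
<ᵇ-false z≤n       = refl
<ᵇ-false (s≤s n≤m) = <ᵇ-false n≤m

≤ᵇ-<ᵇ : ∀ m n → (m ≤ᵇ n) ≡ (m <ᵇ suc n)
≤ᵇ-<ᵇ zero    n = refl
≤ᵇ-<ᵇ (suc m) n = refl

sum-ind-below : ∀ (f : ℕ → ℚ) {n N} → n ≤ N → sum N (λ i → f i * ind (i <ᵇ n)) ≡ sum n f
sum-ind-below f {n} {zero}  z≤n = refl
sum-ind-below f {n} {suc N} n≤1+N with ℕₚ.m≤n⇒m<n∨m≡n n≤1+N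
... | inj₁ (s≤s n≤N) = trans (cong₂ _+_ (sum-ind-below f n≤N)
    (trans (cong (λ b → f N * ind b) (<ᵇ-false n≤N)) (*-zeroʳ (f N))))
                         (+-identityʳ _)
... | inj₂ refl      = sum-cong< (suc N) (λ {i} i<n → trans (cong (λ b → f i * ind b) (<ᵇ-true i<n))
    (*-identityʳ (f i)))

sum-ind-above : ∀ (f : ℕ → ℚ) K j → sum (suc K) (λ a → ind (j <ᵇ a) * f a) ≡ sum (K ∸ j) (λ i → f (K ∸ i))
sum-ind-above f zero    j rewrite ℕₚ.0∸n≡0 j = trans (+-identityˡ _) (*-zeroˡ (f 0))
sum-ind-above f (suc K) j with ℕₚ.≤-<-connex j K
... | inj₁ j≤K = begin
  sum (suc K) (λ a → ind (j <ᵇ a) * f a) + ind (j <ᵇ suc K) * f (suc K)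
    ≡⟨ cong₂ _+_ (sum-ind-above f K j) (trans (cong (λ b → ind b * f (suc K)) (<ᵇ-true (s≤s j≤K)))
        (*-identityˡ _)) ⟩
  sum (K ∸ j) (λ i → f (K ∸ i)) + f (suc K)
    ≡⟨ +-comm _ (f (suc K)) ⟩
  f (suc K) + sum (K ∸ j) (λ i → f (K ∸ i))
    ≡⟨ sum-front (K ∸ j) (λ i → f (suc K ∸ i)) ⟨
  sum (suc (K ∸ j)) (λ i → f (suc K ∸ i))
    ≡⟨ cong (λ t → sum t (λ i → f (suc K ∸ i))) (ℕₚ.+-∸-assoc 1 j≤K) ⟨
  sum (suc K ∸ j) (λ i → f (suc K ∸ i)) ∎
  where open ≡-Reasoning
... | inj₂ K<j = begin
  sum (suc (suc K)) (λ a → ind (j <ᵇ a) * f a)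
    ≡⟨ sum-cong< (suc (suc K)) (λ {i} i<2+K → trans
         (cong (λ b → ind b * f i) (<ᵇ-false (ℕₚ.≤-trans (ℕₚ.≤-pred i<2+K) K<j))) (*-zeroˡ (f i))) ⟩
  sum (suc (suc K)) (λ _ → 0ℚ)
    ≡⟨ sum-zero (suc (suc K)) (λ _ → refl) ⟩
  0ℚ
    ≡⟨ cong (λ t → sum t (λ i → f (suc K ∸ i))) (ℕₚ.m≤n⇒m∸n≡0 K<j) ⟨
  sum (suc K ∸ j) (λ i → f (suc K ∸ i)) ∎
  where open ≡-Reasoning

∸-suc : ∀ {m n} → n < m → m ∸ n ≡ suc (m ∸ suc n)
∸-suc {suc m} (s≤s n≤m) = ℕₚ.+-∸-assoc 1 n≤m

module _ (K : ℕ) where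

  wx wy : ℕ → ℚ
  wx b = recip b
  wy a = recip (suc K ∸ a)

  sum> sum≥ : (ℕ → ℚ) → (ℕ → ℚ) → ℕ → ℚ
  sum> wt f j = sum (suc K) (λ a → ind (j <ᵇ a) * (wt a * f a))
  sum≥ wt f j = sum (suc K) (λ a → ind (j ≤ᵇ a) * (wt a * f a))

  sum≥-flip : ∀ wt f {i} → i < K → sum≥ wt f (K ∸ i) ≡ sum> wt f (K ∸ suc i)
  sum≥-flip wt f i<K = cong (sum≥ wt f) (∸-suc i<K)

  -- Reflection makes x act as y: the weight 1/(K - l) of x at K - l is that of y at l + 1, hence
  -- `opY`. A tail strictly above b sees K - b reflected positions; after x the bound is weak, so at
  -- K - i there are i + 1.
  sum≥-x : ∀ a f → (∀ b → b ≤ K → f b ≡ cum K a (K ∸ b)) →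
    ∀ i → i < K → sum≥ wx f (K ∸ i) ≡ cum K (opY a) (suc i)
  sum≥-x a f eq i i<K = begin
    sum≥ wx f (K ∸ i)                                          ≡⟨ sum≥-flip wx f i<K ⟩
    sum> wx f (K ∸ suc i)                                      ≡⟨ sum-ind-above _ K (K ∸ suc i) ⟩
    sum (K ∸ (K ∸ suc i)) (λ l → recip (K ∸ l) * f (K ∸ l))
      ≡⟨ cong (λ t → sum t (λ l → recip (K ∸ l) * f (K ∸ l))) (ℕₚ.m∸[m∸n]≡n i<K) ⟩
    sum (suc i) (λ l → recip (K ∸ l) * f (K ∸ l))              ≡⟨ sum-cong< (suc i) term ⟩
    sum (suc i) (λ l → recip (K ∸ l) * cum K a l)              ≡⟨ sum-recip-cum K a (suc i) i<K ⟩
    cum K (opY a) (suc i) ∎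
    where
    open ≡-Reasoning
    term : ∀ {l} → l < suc i → recip (K ∸ l) * f (K ∸ l) ≡ recip (K ∸ l) * cum K a l
    term {l} l<1+i = cong (recip (K ∸ l) *_) (trans (eq (K ∸ l) (ℕₚ.m∸n≤m K l))
      (cong (cum K a) (ℕₚ.m∸[m∸n]≡n (ℕₚ.≤-trans (ℕₚ.≤-pred l<1+i) (ℕₚ.<⇒≤ i<K)))))

  -- Dually y acts as x: its weight at K - i is 1/(i + 1), the case of `recip-cum`. The strict bound
  -- of a block's first index returns to the form assumed by `sum≥-x`.
  sum>-y : ∀ a f → a 0 ≡ 0ℚ → (∀ i → i < K → f (K ∸ i) ≡ cum K a (suc i)) →
    ∀ j → sum> wy f j ≡ cum K (opX a) (K ∸ j)
  sum>-y a f a0 eq j = begin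
    sum> wy f j                                                      ≡⟨ sum-ind-above _ K j ⟩
    sum (K ∸ j) (λ i → recip (suc K ∸ (K ∸ i)) * f (K ∸ i))          ≡⟨ sum-cong< (K ∸ j) term ⟩
    sum (K ∸ j) (inc K (opX a) ∘ suc)
      ≡⟨ sum-drop (K ∸ j) (inc K (opX a)) (trans (sym (recip-cum K a a0 0)) (*-zeroˡ (cum K a 0))) ⟨
    sum (suc (K ∸ j)) (inc K (opX a))                                ≡⟨ sum-inc K (opX a) (K ∸ j) ⟩
    cum K (opX a) (K ∸ j) ∎
    where
    open ≡-Reasoning
    term : ∀ {i} → i < K ∸ j → recip (suc K ∸ (K ∸ i)) * f (K ∸ i) ≡ inc K (opX a) (suc i)
    term {i} i<K∸j = trans
      (cong₂ (λ s t → recip s * t)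
        (trans (ℕₚ.+-∸-assoc 1 (ℕₚ.m∸n≤m K i)) (cong suc (ℕₚ.m∸[m∸n]≡n (ℕₚ.<⇒≤ i<K)))) (eq i i<K))
      (recip-cum K a a0 (suc i))
      where
      i<K : i < K
      i<K = ℕₚ.<-≤-trans i<K∸j (ℕₚ.m∸n≤m K j)

  sum≥-y : ∀ a f → a 0 ≡ 0ℚ → (∀ i → i < K → f (K ∸ i) ≡ cum K a (suc i)) →
    ∀ i → i < K → sum≥ wy f (K ∸ i) ≡ cum K (opX a) (suc i)
  sum≥-y a f a0 eq i i<K = trans (sum≥-flip wy f i<K) (trans (sum>-y a f a0 eq (K ∸ suc i))
    (cong (cum K (opX a)) (ℕₚ.m∸[m∸n]≡n i<K)))

  -- The nested sums over blocks are built from the right, whereas `inc` of w₁ grows from the left.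
  -- Exchanging the order of summation moves a letter from the tail f to the head l.
  adjoint : ∀ (l : ℕ → ℚ) (p : ℕ → ℕ → Bool) (wt f : ℕ → ℚ) →
    sum (suc K) (λ j → l j * sum (suc K) (λ a → ind (p j a) * (wt a * f a))) ≡
    sum (suc K) (λ a → wt a * sum (suc K) (λ j → l j * ind (p j a)) * f a)
  adjoint l p wt f = begin
    sum (suc K) (λ j → l j * sum (suc K) (λ a → ind (p j a) * (wt a * f a)))
      ≡⟨ sum-cong (suc K) (λ j → trans (sym (sum-*ˡ (suc K) (l j) _))
           (sum-cong (suc K) (λ a → alg (l j) (ind (p j a)) (wt a) (f a)))) ⟩
    sum (suc K) (λ j → sum (suc K) (λ a → wt a * (l j * ind (p j a)) * f a))
      ≡⟨ sum-swap (suc K) (suc K) _ ⟩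
    sum (suc K) (λ a → sum (suc K) (λ j → wt a * (l j * ind (p j a)) * f a))
      ≡⟨ sum-cong (suc K) (λ a → trans (sum-*ʳ (suc K) (f a) _) (cong (_* f a) (sum-*ˡ (suc K) (wt a) _))) ⟩
    sum (suc K) (λ a → wt a * sum (suc K) (λ j → l j * ind (p j a)) * f a) ∎
    where
    open ≡-Reasoning
    alg : ∀ l i w f → l * (i * (w * f)) ≡ w * (l * i) * f
    alg = solve-∀ ℚ-ring

  sum>-adjoint : ∀ l wt f → sum (suc K) (λ j → l j * sum> wt f j) ≡
    sum (suc K) (λ a → wt a * sum a l * f a)
  sum>-adjoint l wt f = trans (adjoint l _<ᵇ_ wt f)
    (sum-cong< (suc K) (λ {a} a<N → cong (λ t → wt a * t * f a) (sum-ind-below l (ℕₚ.<⇒≤ a<N))))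

  sum≥-adjoint : ∀ l wt f → sum (suc K) (λ j → l j * sum≥ wt f j) ≡
    sum (suc K) (λ a → wt a * sum (suc a) l * f a)
  sum≥-adjoint l wt f = trans (adjoint l _≤ᵇ_ wt f)
    (sum-cong< (suc K) (λ {a} a<N → cong (λ t → wt a * t * f a)
      (trans (sum-cong (suc K) (λ j → cong (λ b → l j * ind b) (≤ᵇ-<ᵇ j a))) (sum-ind-below l a<N))))

  -- The index of y exceeds the preceding one, so the inner sum stops below i; shifting i by one
  -- turns the weight 1/(N - i) into the 1/(K - i) of `sum-recip-cum`. The index of x may equal that
  -- of y, so the outer sum includes b.
  inc-yx : ∀ a b → b ≤ K → wx b * sum (suc b) (λ i → wy i * sum i (inc K a)) ≡ inc K (opz₂ a) b
  inc-yx a b b≤K = begin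
    recip b * sum (suc b) (λ i → recip (suc K ∸ i) * sum i (inc K a))
      ≡⟨ cong (recip b *_) (sum-drop b (λ i → recip (suc K ∸ i) * sum i (inc K a))
          (*-zeroʳ (recip (suc K)))) ⟩
    recip b * sum b (λ i → recip (K ∸ i) * sum (suc i) (inc K a))
      ≡⟨ cong (recip b *_) (sum-cong b (λ i → cong (recip (K ∸ i) *_) (sum-inc K a i))) ⟩
    recip b * sum b (λ i → recip (K ∸ i) * cum K a i)
      ≡⟨ cong (recip b *_) (sum-recip-cum K a b b≤K) ⟩
    recip b * cum K (opY a) b
      ≡⟨ recip-cum K (opY a) refl b ⟩
    inc K (opz₂ a) b ∎
    where open ≡-Reasoning

  sum-inc-yx : ∀ a f → sum (suc K) (λ j → inc K a j * sum> wy (sum≥ wx f) j) ≡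
    sum (suc K) (λ j → inc K (opz₂ a) j * f j)
  sum-inc-yx a f = trans (sum>-adjoint (inc K a) wy (sum≥ wx f))
    (trans (sum≥-adjoint (λ i → wy i * sum i (inc K a)) wx f)
      (sum-cong< (suc K) (λ {b} b<N → cong (_* f b) (inc-yx a b (ℕₚ.≤-pred b<N)))))

  sum-inc-x : ∀ a f → a 0 ≡ 0ℚ → sum (suc K) (λ j → inc K a j * sum≥ wx f j) ≡
    sum (suc K) (λ j → inc K (opX a) j * f j)
  sum-inc-x a f a0 = trans (sum≥-adjoint (inc K a) wx f)
    (sum-cong (suc K) (λ b → cong (_* f b) (trans (cong (recip b *_) (sum-inc K a b))
        (recip-cum K a a0 b))))

  cum-ε : ∀ M → cum K (coef ε) M ≡ 1ℚ
  cum-ε M = trans (sum-front K (λ n → coef ε n * (bin M n * bin⁻¹ K n)))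
      (trans (cong (1ℚ * (1ℚ * 1ℚ) +_) (sum-zero K (λ n → *-zeroˡ (bin M (suc n) * bin⁻¹ K (suc n)))))
    refl)

  sum-inc-ε : ∀ (f : ℕ → ℚ) → sum (suc K) (λ j → inc K (coef ε) j * f j) ≡ f 0
  sum-inc-ε f = trans (sum-front K (λ j → inc K (coef ε) j * f j)) (trans (cong₂ _+_
    (trans (cong (_* f 0) (cum-ε 0)) (*-identityˡ (f 0)))
    (sum-zero K (λ j → trans (cong (_* f (suc j)) (cong₂ _-_ (cum-ε (suc j)) (cum-ε j)))
        (*-zeroˡ (f (suc j))))))
    (+-identityʳ (f 0)))

-- Diamond values of words

∑-++ : ∀ xs ys → ∑ (xs ++ ys) ≡ ∑ xs + ∑ ys
∑-++ []       ys = sym (+-identityˡ _)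
∑-++ (q ∷ xs) ys = trans (cong (q +_) (∑-++ xs ys)) (sym (+-assoc q _ _))

module _ {A : Set} where

  ∑-*ˡ : ∀ c (f : A → ℚ) xs → ∑ (map (λ a → c * f a) xs) ≡ c * ∑ (map f xs)
  ∑-*ˡ c f []       = sym (*-zeroʳ c)
  ∑-*ˡ c f (a ∷ xs) = trans (cong (c * f a +_) (∑-*ˡ c f xs)) (sym (*-distribˡ-+ c (f a) _))

  ∑-cong : ∀ {f g : A → ℚ} → (∀ a → f a ≡ g a) → ∀ xs → ∑ (map f xs) ≡ ∑ (map g xs)
  ∑-cong eq xs = cong ∑ (Listₚ.map-cong eq xs)

  ∑-filter : ∀ {P : Pred A 0ℓ} (P? : Decidable P) (f : A → ℚ) xs →
    ∑ (map f (filter P? xs)) ≡ ∑ (map (λ a → ind (does (P? a)) * f a) xs)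
  ∑-filter P? f []       = refl
  ∑-filter P? f (a ∷ xs) with does (P? a)
  ... | true  = cong₂ _+_ (sym (*-identityˡ (f a))) (∑-filter P? f xs)
  ... | false = trans (∑-filter P? f xs)
    (sym (trans (cong (_+ ∑ (map (λ a → ind (does (P? a)) * f a) xs)) (*-zeroˡ (f a)))
        (+-identityˡ (∑ (map (λ a → ind (does (P? a)) * f a) xs)))))

  ∑-cartesianProductWith : ∀ {B C : Set} (f : C → ℚ) (g : A → B → C) xs ys →
    ∑ (map f (cartesianProductWith g xs ys)) ≡ ∑ (map (λ a → ∑ (map (f ∘ g a) ys)) xs)
  ∑-cartesianProductWith f g []       ys = refl
  ∑-cartesianProductWith f g (a ∷ xs) ys = begin
    ∑ (map f (map (g a) ys ++ cartesianProductWith g xs ys))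
      ≡⟨ cong ∑ (Listₚ.map-++ f (map (g a) ys) _) ⟩
    ∑ (map f (map (g a) ys) ++ map f (cartesianProductWith g xs ys))
      ≡⟨ ∑-++ (map f (map (g a) ys)) _ ⟩
    ∑ (map f (map (g a) ys)) + ∑ (map f (cartesianProductWith g xs ys))
      ≡⟨ cong₂ _+_ (cong ∑ (sym (Listₚ.map-∘ ys))) (∑-cartesianProductWith f g xs ys) ⟩
    ∑ (map (f ∘ g a) ys) + ∑ (map (λ a → ∑ (map (f ∘ g a) ys)) xs) ∎
    where open ≡-Reasoning

∑-applyUpTo : ∀ (f : ℕ → ℚ) g n → ∑ (map f (applyUpTo g n)) ≡ sum n (f ∘ g)
∑-applyUpTo f g zero    = refl
∑-applyUpTo f g (suc n) = trans (cong (f (g 0) +_) (∑-applyUpTo f (g ∘ suc) n)) (sym (sum-front n (f ∘ g)))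

∑-vectors₁ : ∀ N (f : Vec ℕ 1 → ℚ) → ∑ (map f (vectors (upTo N) 1)) ≡ sum N (λ a → f (a ∷ []))
∑-vectors₁ N f = trans (∑-cartesianProductWith f _∷_ (upTo N) ([] ∷ []))
  (trans (∑-applyUpTo _ id N) (sum-cong N (λ a → +-identityʳ (f (a ∷ [])))))

∑-vectors₂ : ∀ N (f : Vec ℕ 2 → ℚ) →
  ∑ (map f (vectors (upTo N) 2)) ≡ sum N (λ a → sum N (λ b → f (a ∷ b ∷ [])))
∑-vectors₂ N f = trans (∑-cartesianProductWith f _∷_ (upTo N) (vectors (upTo N) 1))
  (trans (∑-applyUpTo _ id N) (sum-cong N (λ a → ∑-vectors₁ N (f ∘ (a ∷_)))))

ind-∧ : ∀ a b → ind (a ∧ b) ≡ ind a * ind b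
ind-∧ true  b = sym (*-identityˡ (ind b))
ind-∧ false b = sym (*-zeroˡ (ind b))

linked : ∀ {k} → Vec ℕ k → Bool
linked v = does (linked? ℕ._≤?_ v)

-- Carrying the last index j of the preceding block makes Valid recursive over blocks.
validAbove : ℕ → ℕ → ∀ {es} → Indices es → Bool
validAbove N j []               = true
validAbove N j ((n , m) ∷ rest) =
  (j <ᵇ Vec.head n) ∧ (linked (n Vec.++ m) ∧ ((Vec.last m <ᵇ N) ∧ validAbove N (Vec.last m) rest))

-- A head above the previous last index is positive, so its two tests merge into one comparison with
-- the carried index.
<ᵇ-∧-0<ᵇ : ∀ j h b → (j <ᵇ h) ∧ ((0 <ᵇ h) ∧ b) ≡ (j <ᵇ h) ∧ b
<ᵇ-∧-0<ᵇ j zero    b = refl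
<ᵇ-∧-0<ᵇ j (suc h) b = refl

valid?-validAbove : ∀ N {es} (i : Indices es) → does (valid? N i) ≡ validAbove N 0 i
valid?-validAbove N []               = refl
valid?-validAbove N ((n , m) ∷ [])   = cong (λ b → (0 <ᵇ Vec.head n) ∧ (linked (n Vec.++ m) ∧ b))
  (sym (Boolₚ.∧-identityʳ (Vec.last m <ᵇ N)))
valid?-validAbove N ((n , m) ∷ rest@((n′ , m′) ∷ _)) = begin
  (h ∧ (l ∧ t)) ∧ ((Vec.last m <ᵇ Vec.head n′) ∧ does (valid? N rest))
    ≡⟨ cong (λ b → (h ∧ (l ∧ t)) ∧ ((Vec.last m <ᵇ Vec.head n′) ∧ b)) (valid?-validAbove N rest) ⟩
  (h ∧ (l ∧ t)) ∧ ((Vec.last m <ᵇ Vec.head n′) ∧ validAbove N 0 rest)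
    ≡⟨ cong ((h ∧ (l ∧ t)) ∧_) (<ᵇ-∧-0<ᵇ (Vec.last m) (Vec.head n′) _) ⟩
  (h ∧ (l ∧ t)) ∧ validAbove N (Vec.last m) rest
    ≡⟨ trans (Boolₚ.∧-assoc h (l ∧ t) _) (cong (h ∧_) (Boolₚ.∧-assoc l t _)) ⟩
  h ∧ (l ∧ (t ∧ validAbove N (Vec.last m) rest)) ∎
  where
  open ≡-Reasoning
  h = 0 <ᵇ Vec.head n
  l = linked (n Vec.++ m)
  t = Vec.last m <ᵇ N

sumAbove : ℕ → ℕ → List (ℕ × ℕ) → ℚ
sumAbove N j es = ∑ (map (λ i → ind (validAbove N j i) * summand N i) (indices (upTo N) es))

ζ◇-sumAbove : ∀ es N .{{_ : NonZero N}} → ζ◇ es N ≡ sumAbove N 0 (toList⁺ es)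
ζ◇-sumAbove es N = trans (∑-filter (valid? N) (summand N) (indices (upTo N) (toList⁺ es)))
  (∑-cong (λ i → cong (λ b → ind b * summand N i) (valid?-validAbove N i)) (indices (upTo N) (toList⁺ es)))

blockTerm : ℕ → ℕ → List (ℕ × ℕ) → ∀ {α β} → Vec ℕ (suc α) → Vec ℕ (suc β) → ℚ
blockTerm N j es n m = ind (j <ᵇ Vec.head n) * (ind (linked (n Vec.++ m)) * (ind (Vec.last m <ᵇ N) *
  (∏ (map (λ j → recip (N ∸ j)) (Vec.toList n)) * ∏ (map recip (Vec.toList m)) * sumAbove N
      (Vec.last m) es)))

sumAbove-∷ : ∀ N j α β es → sumAbove N j ((α , β) ∷ es) ≡
  ∑ (map (λ n → ∑ (map (λ m → blockTerm N j es n m) (vectors (upTo N) (suc β)))) (vectors (upTo N) (suc α)))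
sumAbove-∷ N j α β es = begin
  sumAbove N j ((α , β) ∷ es)
    ≡⟨ ∑-cartesianProductWith (term {(α , β) ∷ es} j) _∷_ (cartesianProduct ns ms) (indices (upTo N) es) ⟩
  ∑ (map (λ nm → ∑ (map (term j ∘ (nm ∷_)) (indices (upTo N) es))) (cartesianProduct ns ms))
    ≡⟨ ∑-cartesianProductWith _ _,_ ns ms ⟩
  ∑ (map (λ n → ∑ (map (λ m → ∑ (map (term j ∘ ((n , m) ∷_)) (indices (upTo N) es))) ms)) ns)
    ≡⟨ ∑-cong (λ n → ∑-cong (λ m → inner n m) ms) ns ⟩
  ∑ (map (λ n → ∑ (map (λ m → blockTerm N j es n m) ms)) ns) ∎
  where
  open ≡-Reasoning
  ns = vectors (upTo N) (suc α)
  ms = vectors (upTo N) (suc β)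
  term : ∀ {es} → ℕ → Indices es → ℚ
  term j i = ind (validAbove N j i) * summand N i
  alg : ∀ a b c d p s → a * (b * (c * d)) * (p * s) ≡ a * (b * (c * p)) * (d * s)
  alg = solve-∀ ℚ-ring
  alg₂ : ∀ a b c p s → a * (b * (c * p)) * s ≡ a * (b * (c * (p * s)))
  alg₂ = solve-∀ ℚ-ring
  inner : ∀ n m → ∑ (map (term j ∘ ((n , m) ∷_)) (indices (upTo N) es)) ≡ blockTerm N j es n m
  inner n m = begin
    ∑ (map (term j ∘ ((n , m) ∷_)) (indices (upTo N) es))
      ≡⟨ ∑-cong (λ i → trans (cong (_* (w * summand N i))
           (trans (ind-∧ a _) (cong (ind a *_) (trans (ind-∧ b _) (cong (ind b *_) (ind-∧ c _))))))
           (alg (ind a) (ind b) (ind c) (ind (validAbove N (Vec.last m) i)) w (summand N i)))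
               (indices (upTo N) es) ⟩
    ∑ (map (λ i → ind a * (ind b * (ind c * w)) * term (Vec.last m) i) (indices (upTo N) es))
      ≡⟨ ∑-*ˡ (ind a * (ind b * (ind c * w))) (term (Vec.last m)) (indices (upTo N) es) ⟩
    ind a * (ind b * (ind c * w)) * sumAbove N (Vec.last m) es
      ≡⟨ alg₂ (ind a) (ind b) (ind c) w (sumAbove N (Vec.last m) es) ⟩
    blockTerm N j es n m ∎
    where
    a = j <ᵇ Vec.head n
    b = linked (n Vec.++ m)
    c = Vec.last m <ᵇ N
    w = ∏ (map (λ j → recip (N ∸ j)) (Vec.toList n)) * ∏ (map recip (Vec.toList m))

-- The blocks of ιʷ w, followed by es, and the blocks of τ (ιʷ w).
blocks : Word²³ → List (ℕ × ℕ) → List (ℕ × ℕ)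
blocks ε      es = es
blocks (w z₂) es = blocks w ((0 , 0) ∷ es)
blocks (w z₃) es = blocks w ((0 , 1) ∷ es)

τ-blocks : Word²³ → List (ℕ × ℕ)
τ-blocks ε      = []
τ-blocks (w z₂) = (0 , 0) ∷ τ-blocks w
τ-blocks (w z₃) = (1 , 0) ∷ τ-blocks w

module _ (K : ℕ) where

  ind-<N : ∀ {b} → b < suc K → ind (b <ᵇ suc K) ≡ 1ℚ
  ind-<N b<N = cong ind (<ᵇ-true b<N)

  ind-∧-true : ∀ a → ind (a ∧ true) ≡ ind a
  ind-∧-true a = cong ind (Boolₚ.∧-identityʳ a)

  sum-*ˡ₂ : ∀ c d (f : ℕ → ℚ) → sum (suc K) (λ b → c * (d * f b)) ≡ c * (d * sum (suc K) f)
  sum-*ˡ₂ c d f = trans (sum-*ˡ (suc K) c _) (cong (c *_) (sum-*ˡ (suc K) d f))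

  blockRow : ℕ → List (ℕ × ℕ) → ∀ {α} β → Vec ℕ (suc α) → ℚ
  blockRow j es β n = ∑ (map (λ m → blockTerm (suc K) j es n m) (vectors (upTo (suc K)) (suc β)))

  sumAbove-yx : ∀ j es → sumAbove (suc K) j ((0 , 0) ∷ es) ≡
    sum> K (wy K) (sum≥ K (wx K) (λ b → sumAbove (suc K) b es)) j
  sumAbove-yx j es = trans (sumAbove-∷ (suc K) j 0 0 es) (trans (∑-vectors₁ (suc K) (blockRow j es 0))
    (sum-cong (suc K) (λ a → trans (∑-vectors₁ (suc K) (blockTerm (suc K) j es (a ∷ [])))
      (trans (sum-cong< (suc K) (term a)) (sum-*ˡ₂ (ind (j <ᵇ a)) (wy K a) _)))))
    where
    alg : ∀ p q u v s → p * (q * (1ℚ * ((u * 1ℚ) * (v * 1ℚ) * s))) ≡ p * (u * (q * (v * s)))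
    alg = solve-∀ ℚ-ring
    term : ∀ a {b} → b < suc K → blockTerm (suc K) j es (a ∷ []) (b ∷ []) ≡
      ind (j <ᵇ a) * (wy K a * (ind (a ≤ᵇ b) * (wx K b * sumAbove (suc K) b es)))
    term a {b} b<N = trans
      (cong₂ (λ s t → ind (j <ᵇ a) * (s * (t * ((wy K a * 1ℚ) * (wx K b * 1ℚ) * sumAbove (suc K) b es))))
        (ind-∧-true (a ≤ᵇ b)) (ind-<N b<N))
      (alg (ind (j <ᵇ a)) (ind (a ≤ᵇ b)) (wy K a) (wx K b) (sumAbove (suc K) b es))

  sumAbove-yxx : ∀ j es → sumAbove (suc K) j ((0 , 1) ∷ es) ≡
    sum> K (wy K) (sum≥ K (wx K) (sum≥ K (wx K) (λ c → sumAbove (suc K) c es))) j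
  sumAbove-yxx j es = trans (sumAbove-∷ (suc K) j 0 1 es) (trans (∑-vectors₁ (suc K) (blockRow j es 1))
    (sum-cong (suc K) (λ a → trans (∑-vectors₂ (suc K) (blockTerm (suc K) j es (a ∷ [])))
      (trans (sum-cong (suc K) (λ b → trans (sum-cong< (suc K) (term a b))
        (trans (sum-*ˡ₂ (ind (j <ᵇ a)) (wy K a) _)
            (cong (λ t → ind (j <ᵇ a) * (wy K a * t)) (sum-*ˡ₂ (ind (a ≤ᵇ b)) (wx K b) _)))))
        (sum-*ˡ₂ (ind (j <ᵇ a)) (wy K a) _)))))
    where
    alg : ∀ p q r u v w s → p * (q * r * (1ℚ * ((u * 1ℚ) * (v * (w * 1ℚ)) * s))) ≡
      p * (u * (q * (v * (r * (w * s)))))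
    alg = solve-∀ ℚ-ring
    term : ∀ a b {c} → c < suc K → blockTerm (suc K) j es (a ∷ []) (b ∷ c ∷ []) ≡
      ind (j <ᵇ a) * (wy K a * (ind (a ≤ᵇ b) *
          (wx K b * (ind (b ≤ᵇ c) * (wx K c * sumAbove (suc K) c es)))))
    term a b {c} c<N = trans
      (cong₂ (λ s t → ind (j <ᵇ a) * (s * (t *
          ((wy K a * 1ℚ) * (wx K b * (wx K c * 1ℚ)) * sumAbove (suc K) c es))))
        (trans (ind-∧ (a ≤ᵇ b) _) (cong (ind (a ≤ᵇ b) *_) (ind-∧-true (b ≤ᵇ c)))) (ind-<N c<N))
      (alg (ind (j <ᵇ a)) (ind (a ≤ᵇ b)) (ind (b ≤ᵇ c)) (wy K a) (wx K b) (wx K c) (sumAbove (suc K) c es))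

  sumAbove-yyx : ∀ j es → sumAbove (suc K) j ((1 , 0) ∷ es) ≡
    sum> K (wy K) (sum≥ K (wy K) (sum≥ K (wx K) (λ c → sumAbove (suc K) c es))) j
  sumAbove-yyx j es = trans (sumAbove-∷ (suc K) j 1 0 es) (trans (∑-vectors₂ (suc K) (blockRow j es 0))
    (sum-cong (suc K) (λ a → trans (sum-cong (suc K)
        (λ b → trans (∑-vectors₁ (suc K) (blockTerm (suc K) j es (a ∷ b ∷ [])))
      (trans (sum-cong< (suc K) (term a b))
        (trans (sum-*ˡ₂ (ind (j <ᵇ a)) (wy K a) _)
            (cong (λ t → ind (j <ᵇ a) * (wy K a * t)) (sum-*ˡ₂ (ind (a ≤ᵇ b)) (wy K b) _))))))
        (sum-*ˡ₂ (ind (j <ᵇ a)) (wy K a) _))))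
    where
    alg : ∀ p q r u v w s → p * (q * r * (1ℚ * ((u * (v * 1ℚ)) * (w * 1ℚ) * s))) ≡
      p * (u * (q * (v * (r * (w * s)))))
    alg = solve-∀ ℚ-ring
    term : ∀ a b {c} → c < suc K → blockTerm (suc K) j es (a ∷ b ∷ []) (c ∷ []) ≡
      ind (j <ᵇ a) * (wy K a * (ind (a ≤ᵇ b) *
          (wy K b * (ind (b ≤ᵇ c) * (wx K c * sumAbove (suc K) c es)))))
    term a b {c} c<N = trans
      (cong₂ (λ s t → ind (j <ᵇ a) * (s * (t *
          ((wy K a * (wy K b * 1ℚ)) * (wx K c * 1ℚ) * sumAbove (suc K) c es))))
        (trans (ind-∧ (a ≤ᵇ b) _) (cong (ind (a ≤ᵇ b) *_) (ind-∧-true (b ≤ᵇ c)))) (ind-<N c<N))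
      (alg (ind (j <ᵇ a)) (ind (a ≤ᵇ b)) (ind (b ≤ᵇ c)) (wy K a) (wy K b) (wx K c) (sumAbove (suc K) c es))

  -- Words in z₂ and z₃ grow on the right, so each step hands the last block of w to the tail; es
  -- must therefore be arbitrary in the induction.
  sumAbove-blocks : ∀ w es → sumAbove (suc K) 0 (blocks w es) ≡
    sum (suc K) (λ j → inc K (coef w) j * sumAbove (suc K) j es)
  sumAbove-blocks ε      es = sym (sum-inc-ε K (λ j → sumAbove (suc K) j es))
  sumAbove-blocks (w z₂) es = trans (sumAbove-blocks w ((0 , 0) ∷ es))
    (trans (sum-cong (suc K) (λ j → cong (inc K (coef w) j *_) (sumAbove-yx j es)))
      (sum-inc-yx K (coef w) _))
  sumAbove-blocks (w z₃) es = trans (sumAbove-blocks w ((0 , 1) ∷ es))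
    (trans (sum-cong (suc K) (λ j → cong (inc K (coef w) j *_) (sumAbove-yxx j es)))
      (trans (sum-inc-yx K (coef w) _) (sum-inc-x K (opz₂ (coef w)) _ refl)))

  -- As τ reverses, the last letter of w gives the first block, which is where `sumAbove` unfolds.
  -- The block yyx of z₃ is read from its end: x gives `opY`, then each y gives `opX`.
  sumAbove-τ-blocks : ∀ w j → sumAbove (suc K) j (τ-blocks w) ≡ cum K (coef w) (K ∸ j)
  sumAbove-τ-blocks ε      j = sym (cum-ε K (K ∸ j))
  sumAbove-τ-blocks (w z₂) j = trans (sumAbove-yx j (τ-blocks w))
    (sum>-y K (opY (coef w)) _ refl (sum≥-x K (coef w) _ (λ b _ → sumAbove-τ-blocks w b)) j)
  sumAbove-τ-blocks (w z₃) j = trans (sumAbove-yyx j (τ-blocks w))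
    (sum>-y K (opX (opY (coef w))) _ refl
      (sum≥-y K (opY (coef w)) _ refl (sum≥-x K (coef w) _ (λ b _ → sumAbove-τ-blocks w b))) j)

  sumAbove-pair : ∀ v w → sumAbove (suc K) 0 (blocks v (τ-blocks w)) ≡ pair K K (coef v) (coef w)
  sumAbove-pair v w = trans (sumAbove-blocks v (τ-blocks w))
    (trans (sum-cong (suc K) (λ j → cong (inc K (coef v) j *_) (sumAbove-τ-blocks w j)))
      (sum-inc-cum K (coef v) (coef w)))

-- Block lists and the words they encode

wordOf-blocks : ∀ w es → ιʷ w ++ wordOf es ≡ wordOf (blocks w es)
wordOf-blocks ε      es = refl
wordOf-blocks (w z₂) es = trans (Listₚ.++-assoc (ιʷ w) (z 2) (wordOf es)) (wordOf-blocks w ((0 , 0) ∷ es))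
wordOf-blocks (w z₃) es = trans (Listₚ.++-assoc (ιʷ w) (z 3) (wordOf es)) (wordOf-blocks w ((0 , 1) ∷ es))

τʷ : Word → Word
τʷ = reverse ∘ map swap

τʷ-++ : ∀ u v → τʷ (u ++ v) ≡ τʷ v ++ τʷ u
τʷ-++ u v = trans (cong reverse (Listₚ.map-++ swap u v)) (Listₚ.reverse-++ (map swap u) (map swap v))

wordOf-τ-blocks : ∀ w → τʷ (ιʷ w) ≡ wordOf (τ-blocks w)
wordOf-τ-blocks ε      = refl
wordOf-τ-blocks (w z₂) = trans (τʷ-++ (ιʷ w) (z 2)) (cong (λ v → y ∷ x ∷ v) (wordOf-τ-blocks w))
wordOf-τ-blocks (w z₃) = trans (τʷ-++ (ιʷ w) (z 3)) (cong (λ v → y ∷ y ∷ x ∷ v) (wordOf-τ-blocks w))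

replicate-∷ : ∀ {A : Set} n (a : A) w → replicate n a ++ a ∷ w ≡ a ∷ replicate n a ++ w
replicate-∷ zero    a w = refl
replicate-∷ (suc n) a w = cong (a ∷_) (replicate-∷ n a w)

-- The u for which the block list encodes y u x; `exponents` takes this u as its argument.
interior : ℕ × ℕ → List (ℕ × ℕ) → Word
interior (α , β) []       = replicate α y ++ replicate β x
interior (α , β) (e ∷ es) = replicate α y ++ replicate β x ++ x ∷ y ∷ interior e es

wordOf-∷ : ∀ e es → wordOf (e ∷ es) ≡ y ∷ interior e es ∷ʳ x
wordOf-∷ (α , β) []       = cong (y ∷_) (begin
  replicate α y ++ x ∷ replicate β x ++ []     ≡⟨ cong (replicate α y ++_) (replicate-∷ β x []) ⟨
  replicate α y ++ replicate β x ∷ʳ x          ≡⟨ Listₚ.++-assoc (replicate α y) (replicate β x) [ x ] ⟨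
  (replicate α y ++ replicate β x) ∷ʳ x        ∎)
  where open ≡-Reasoning
wordOf-∷ (α , β) (e ∷ es) = cong (y ∷_) (begin
  replicate α y ++ x ∷ replicate β x ++ wordOf (e ∷ es)
    ≡⟨ cong (λ w → replicate α y ++ x ∷ replicate β x ++ w) (wordOf-∷ e es) ⟩
  replicate α y ++ x ∷ replicate β x ++ y ∷ interior e es ∷ʳ x
    ≡⟨ cong (replicate α y ++_) (replicate-∷ β x _) ⟨
  replicate α y ++ replicate β x ++ x ∷ y ∷ interior e es ∷ʳ x
    ≡⟨ cong (replicate α y ++_) (Listₚ.++-assoc (replicate β x) (x ∷ y ∷ interior e es) [ x ]) ⟨
  replicate α y ++ (replicate β x ++ x ∷ y ∷ interior e es) ∷ʳ x
    ≡⟨ Listₚ.++-assoc (replicate α y) _ [ x ] ⟨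
  interior (α , β) (e ∷ es) ∷ʳ x ∎)
  where open ≡-Reasoning

exponents-yⁿ : ∀ α {β es} u → exponents u ≡ (0 , β) ∷ es → exponents (replicate α y ++ u) ≡ (α , β) ∷ es
exponents-yⁿ zero    u eq = eq
exponents-yⁿ (suc α) u eq = cong raiseα (exponents-yⁿ α u eq)

exponents-xⁿ : ∀ β → exponents (replicate β x) ≡ (0 , β) ∷ []
exponents-xⁿ zero          = refl
exponents-xⁿ (suc zero)    = refl
exponents-xⁿ (suc (suc β)) = cong raiseβ (exponents-xⁿ (suc β))

exponents-xⁿxy : ∀ β u → exponents (replicate β x ++ x ∷ y ∷ u) ≡ (0 , β) ∷ toList⁺ (exponents u)
exponents-xⁿxy zero          u = refl
exponents-xⁿxy (suc zero)    u = refl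
exponents-xⁿxy (suc (suc β)) u = cong raiseβ (exponents-xⁿxy (suc β) u)

-- The converse of `wordOf-exponents`: a block list is recovered from its word, so the diamond value
-- of a word may be computed from the list that encodes it.
exponents-interior : ∀ e es → exponents (interior e es) ≡ e ∷ es
exponents-interior (α , β) []       = exponents-yⁿ α _ (exponents-xⁿ β)
exponents-interior (α , β) (e ∷ es) = exponents-yⁿ α _
  (trans (exponents-xⁿxy β (interior e es)) (cong (λ t → (0 , β) ∷ toList⁺ t) (exponents-interior e es)))

dropLast : Word → Word
dropLast []          = []
dropLast (_ ∷ [])    = []
dropLast (a ∷ b ∷ w) = a ∷ dropLast (b ∷ w)

dropLast-∷ʳ : ∀ w a → dropLast (w ∷ʳ a) ≡ w
dropLast-∷ʳ []          a = refl
dropLast-∷ʳ (b ∷ [])    a = refl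
dropLast-∷ʳ (b ∷ c ∷ w) a = cong (b ∷_) (dropLast-∷ʳ (c ∷ w) a)

-- Extension from words to linear combinations

module _ (K : ℕ) where

  -- Only meaningful on words of the form 1 or y u x.
  ζʷ : Word → ℚ
  ζʷ []      = 1ℚ
  ζʷ (_ ∷ w) = ζ◇ (exponents (dropLast w)) (suc K)

  ζʷ-yux : ∀ u → ζʷ (y ∷ u ∷ʳ x) ≡ ζ◇ (exponents u) (suc K)
  ζʷ-yux u = cong (λ v → ζ◇ (exponents v) (suc K)) (dropLast-∷ʳ u x)

  -- Replaces the map on ℋ⁰, which depends on a membership witness, by a linear functional on all of
  -- ℋ, to which the rules for bilinear products apply.
  Z◇-evalℚ : ∀ {p} (as : All⁰ p) → Z◇ p (All⁰⇒∈ℋ⁰ as) (suc K) ≡ evalℚ ζʷ p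
  Z◇-evalℚ []                           = refl
  Z◇-evalℚ {(d , _) ∷ p} (one ∷ as)     = begin
    (d ℤ.+ constant-part as) / 1 + e             ≡⟨ cong (_+ e) (/1-homo-+ d (constant-part as)) ⟩
    (d / 1 + constant-part as / 1) + e           ≡⟨ +-assoc (d / 1) _ e ⟩
    d / 1 + (constant-part as / 1 + e)           ≡⟨ cong₂ _+_ (sym (*-identityʳ (d / 1))) (Z◇-evalℚ as) ⟩
    d / 1 * 1ℚ + evalℚ ζʷ p                      ∎
    where
    open ≡-Reasoning
    e = evalℚ (λ u → ζ◇ (exponents u) (suc K)) (y·x-part as)
  Z◇-evalℚ {(d , _) ∷ p} (yux u ∷ as)   = begin
    c + (d / 1 * ζ◇ (exponents u) (suc K) + e)   ≡⟨ alg c (d / 1 * ζ◇ (exponents u) (suc K)) e ⟩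
    d / 1 * ζ◇ (exponents u) (suc K) + (c + e)
      ≡⟨ cong₂ _+_ (cong (d / 1 *_) (sym (ζʷ-yux u))) (Z◇-evalℚ as) ⟩
    d / 1 * ζʷ (y ∷ u ∷ʳ x) + evalℚ ζʷ p         ∎
    where
    open ≡-Reasoning
    c = constant-part as / 1
    e = evalℚ (λ u → ζ◇ (exponents u) (suc K)) (y·x-part as)
    alg : ∀ c s e → c + (s + e) ≡ s + (c + e)
    alg = solve-∀ ℚ-ring

  ζʷ-wordOf : ∀ es → ζʷ (wordOf es) ≡ sumAbove (suc K) 0 es
  ζʷ-wordOf []       = refl
  ζʷ-wordOf (e ∷ es) = begin
    ζʷ (wordOf (e ∷ es))                       ≡⟨ cong ζʷ (wordOf-∷ e es) ⟩
    ζʷ (y ∷ interior e es ∷ʳ x)                ≡⟨ ζʷ-yux (interior e es) ⟩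
    ζ◇ (exponents (interior e es)) (suc K)     ≡⟨ cong (λ t → ζ◇ t (suc K)) (exponents-interior e es) ⟩
    ζ◇ (e ∷ es) (suc K)                        ≡⟨ ζ◇-sumAbove (e ∷ es) (suc K) ⟩
    sumAbove (suc K) 0 (e ∷ es)                ∎
    where open ≡-Reasoning

  ζʷ-pair : ∀ v w → ζʷ (ιʷ v ++ τʷ (ιʷ w)) ≡ pair K K (coef v) (coef w)
  ζʷ-pair v w = begin
    ζʷ (ιʷ v ++ τʷ (ιʷ w))                      ≡⟨ cong (λ t → ζʷ (ιʷ v ++ t)) (wordOf-τ-blocks w) ⟩
    ζʷ (ιʷ v ++ wordOf (τ-blocks w))          ≡⟨ cong ζʷ (wordOf-blocks v (τ-blocks w)) ⟩
    ζʷ (wordOf (blocks v (τ-blocks w)))     ≡⟨ ζʷ-wordOf (blocks v (τ-blocks w)) ⟩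
    sumAbove (suc K) 0 (blocks v (τ-blocks w)) ≡⟨ sumAbove-pair K v w ⟩
    pair K K (coef v) (coef w) ∎
    where open ≡-Reasoning

  -- The case w₂ = 1, where τ contributes no letters. It shows that the words occurring in w₁ ⋆ w₂
  -- are evaluated by T_K(-, ε).
  ζʷ-value : ∀ w → ζʷ (ιʷ w) ≡ value K K w
  ζʷ-value w = trans (cong ζʷ (sym (Listₚ.++-identityʳ (ιʷ w)))) (ζʷ-pair w ε)

  ζʷ-⋆ : ∀ v w → ζʷ (ιʷ v ++ τʷ (ιʷ w)) ≡ evalℚ (ζʷ ∘ ιʷ) (v ⋆ʷ w)
  ζʷ-⋆ v w = trans (ζʷ-pair v w) (trans (value-⋆ K v w K ℕₚ.≤-refl)
    (evalℚ-pointwise (λ u → sym (ζʷ-value u)) (v ⋆ʷ w)))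

  evalℚ-τ-⋆ : ∀ p q → evalℚ ζʷ (ι p · τ (ι q)) ≡ evalℚ ζʷ (ι (p ⋆ q))
  evalℚ-τ-⋆ p q = begin
    evalℚ ζʷ (ι p · τ (ι q))
      ≡⟨ evalℚ-bilinear ζʷ (λ u v → ⟨ u ++ v ⟩) (ι p) (τ (ι q)) ⟩
    evalℚ (λ u → evalℚ (λ v → evalℚ ζʷ ⟨ u ++ v ⟩) (τ (ι q))) (ι p)
      ≡⟨ evalℚ-mapBasis _ ιʷ p ⟩
    evalℚ (λ u → evalℚ (λ v → evalℚ ζʷ ⟨ ιʷ u ++ v ⟩) (τ (ι q))) p
      ≡⟨ evalℚ-pointwise (λ u → trans (evalℚ-mapBasis _ τʷ (ι q)) (evalℚ-mapBasis _ ιʷ q)) p ⟩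
    evalℚ (λ u → evalℚ (λ v → evalℚ ζʷ ⟨ ιʷ u ++ τʷ (ιʷ v) ⟩) q) p
      ≡⟨ evalℚ-pointwise (λ u → evalℚ-pointwise (λ v →
           trans (evalℚ-⟨⟩ ζʷ (ιʷ u ++ τʷ (ιʷ v))) (ζʷ-⋆ u v)) q) p ⟩
    evalℚ (λ u → evalℚ (λ v → evalℚ (ζʷ ∘ ιʷ) (u ⋆ʷ v)) q) p
      ≡⟨ evalℚ-bilinear (ζʷ ∘ ιʷ) _⋆ʷ_ p q ⟨
    evalℚ (ζʷ ∘ ιʷ) (p ⋆ q)
      ≡⟨ evalℚ-mapBasis ζʷ ιʷ (p ⋆ q) ⟨
    evalℚ ζʷ (ι (p ⋆ q)) ∎
    where open ≡-Reasoning

corollary1p4 : (w₁ w₂ : ℋ²³) → Z◇ (ι w₁ · τ (ι w₂)) (ι·τι∈ℋ⁰ w₁ w₂) ≗ Z◇ (ι (w₁ ⋆ w₂)) (ι∈ℋ⁰ (w₁ ⋆ w₂))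
corollary1p4 w₁ w₂ (suc K) = trans (Z◇-evalℚ K (All⁰-· (All⁰-ι w₁) (All⁰-τ (All⁰-ι w₂))))
  (trans (evalℚ-τ-⋆ K w₁ w₂) (sym (Z◇-evalℚ K (All⁰-ι (w₁ ⋆ w₂)))))
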